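{- Let $S$ be a topological tree. Then for all integers $n \geq |S|$, $$0\leq \max_{\substack{|T|=n \\ T\text{ topological tree}}} \gamma(S,T) - J(S) \leq \frac{|S|(|S|-1)}{n}.$$ In particular, $$J(S)=\lim_{n\to \infty}\ \max_{\substack{|T|=n \\ T\text{ topological tree}}} \gamma(S,T).$$
   Context: A topological tree is a finite rooted tree in which every non-leaf vertex has outdegree (number of children) at least $2$; the single-vertex tree is allowed, its vertex being both root and leaf. Trees are considered up to isomorphism of rooted trees (unordered, unlabelled). $|T|$ denotes the number of leaves of $T$. A nonempty set $L$ of leaves of $T$ induces a topological tree: take the smallest subtree of $T$ connecting the leaves in $L$, rooted at the most recent common ancestor of $L$, and suppress (erase, joining the neighbours) all vertices of outdegree $1$. For topological trees $S,T$, $c(S,T)$ is the number of subsets of the leaf set of $T$ whose induced tree is isomorphic, as a rooted tree, to $S$, and $\gamma(S,T)=c(S,T)/\binom{|T|}{|S|}$ (for $|T|\ge |S|$). The inducibility of $S$ is $$J(S)=\limsup_{n\to\infty}\ \max_{\substack{|T|=n\\ T\text{ topological tree}}}\gamma(S,T).$$ -}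

module Defs where

open import Data.Empty using (⊥-elim)
open import Data.Fin.Subset using (Subset; inside; outside)
open import Data.Integer.Base as ℤ using ()
open import Data.List.Base as List
  using (List; []; _∷_; _++_; length; filter; map; cartesianProductWith; replicate)
import Data.List.Extrema
open import Data.List.Membership.Propositional using (_∈_)
open import Data.List.Membership.Propositional.Properties
  using (∈-filter⁺; ∈-filter⁻; ∈-map⁺; ∈-map⁻; ∈-cartesianProductWith⁺)
open import Data.List.Properties using (length-replicate)
import Data.List.Relation.Binary.Permutation.Homogeneous as Perm
open Perm using (Permutation; refl; prep; swap; trans)
import Data.List.Relation.Binary.Permutation.Setoid.Properties as PermProps
open import Data.List.Relation.Binary.Pointwise.Base using (Pointwise; []; _∷_)
open import Data.List.Relation.Unary.All as All using (All; []; _∷_)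
import Data.List.Relation.Unary.All.Properties as Allₚ
open import Data.List.Relation.Unary.Any as Any using (Any; here; there; _─_)
open import Data.Maybe.Base as Maybe using (Maybe; just; nothing)
import Data.Maybe.Relation.Unary.Any as MAny
open import Data.Nat.Base using (ℕ; zero; suc; _+_; _≤_; _⊔_; z≤n; s≤s)
open import Data.Nat.Combinatorics using (_C_)
import Data.Nat.Properties as ℕ
open import Data.Product.Base using (Σ; ∃; _×_; _,_; proj₂)
open import Data.Rational.Base as ℚ using (ℚ; 0ℚ; ½)
import Data.Rational.Properties as ℚ
open import Data.Rational.Solver using (module +-*-Solver)
open import Data.Sum.Base using (inj₁; inj₂)
open import Data.Vec.Base as Vec using ([]; _∷_)
open import Function.Base using (_∘_)
open import Relation.Binary.Bundles using (DecTotalOrder; Setoid)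
open import Relation.Binary.PropositionalEquality as ≡ using (_≡_)
open import Relation.Nullary.Decidable using (Dec; yes; no; map′; _×-dec_)

-- The order of the children in the list carries no meaning: trees are
-- compared by _≅_ below.
data Tree : Set where
  node : List Tree → Tree

data Topological : Tree → Set where
  leaf : Topological (node [])
  node : ∀ {ts} → 2 ≤ length ts → All Topological ts → Topological (node ts)

infix 4 _≅_ _≅?_ _↭?_

data _≅_ : Tree → Tree → Set where
  node : ∀ {ts us} → Permutation _≅_ ts us → node ts ≅ node us

∣_∣    : Tree → ℕ
leaves : List Tree → ℕ

∣ node [] ∣         = 1
∣ node ts@(_ ∷ _) ∣ = leaves ts

leaves []       = 0
leaves (t ∷ ts) = ∣ t ∣ + leaves ts

≅-refl   : ∀ {t} → t ≅ t
≅-refl*  : ∀ {ts} → Pointwise _≅_ ts ts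
≅-refl  {node ts}  = node (refl ≅-refl*)
≅-refl* {[]}     = []
≅-refl* {t ∷ ts} = ≅-refl ∷ ≅-refl*

≅-sym   : ∀ {t u} → t ≅ u → u ≅ t
≅-sym*  : ∀ {ts us} → Pointwise _≅_ ts us → Pointwise _≅_ us ts
↭-sym   : ∀ {ts us} → Permutation _≅_ ts us → Permutation _≅_ us ts
≅-sym (node p) = node (↭-sym p)
≅-sym* []       = []
≅-sym* (e ∷ es) = ≅-sym e ∷ ≅-sym* es
↭-sym (refl es)    = refl (≅-sym* es)
↭-sym (prep e p)   = prep (≅-sym e) (↭-sym p)
↭-sym (swap d e p) = swap (≅-sym e) (≅-sym d) (↭-sym p)
↭-sym (trans p q)  = trans (↭-sym q) (↭-sym p)

≅-trans : ∀ {t u v} → t ≅ u → u ≅ v → t ≅ v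
≅-trans (node p) (node q) = node (trans p q)

≅-setoid : Setoid _ _
≅-setoid = record
  { Carrier       = Tree
  ; _≈_           = _≅_
  ; isEquivalence = record { refl = ≅-refl ; sym = ≅-sym ; trans = ≅-trans }
  }

private
  module Permₚ = PermProps ≅-setoid

  ↭-remove : ∀ {t us} (p : Any (t ≅_) us) → Permutation _≅_ us (t ∷ (us ─ p))
  ↭-remove (here e)  = prep (≅-sym e) (refl ≅-refl*)
  ↭-remove (there p) =
    trans (prep ≅-refl (↭-remove p)) (swap ≅-refl ≅-refl (refl ≅-refl*))

_≅?_ : ∀ t u → Dec (t ≅ u)
_↭?_ : ∀ ts us → Dec (Permutation _≅_ ts us)

node ts ≅? node us = map′ node (λ { (node p) → p }) (ts ↭? us)

[]       ↭? []       = yes (refl [])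
[]       ↭? (u ∷ us) = no λ p → Permₚ.¬x∷xs↭[] (↭-sym p)
(t ∷ ts) ↭? us with Any.any? (λ u → t ≅? u) us
... | no t∉us = no λ p → t∉us (Permₚ.∈-resp-↭ p (here ≅-refl))
... | yes p   = map′
  (λ q → trans (prep ≅-refl q) (↭-sym (↭-remove p)))
  (λ q → Permₚ.drop-∷ (trans q (↭-remove p)))
  (ts ↭? (us ─ p))

-- Leaves are numbered from left to right, so that a set of leaves of t is
-- a  Subset ∣ t ∣.

-- The union of the paths from the root to the leaves in L (nothing if L
-- is empty).
rootPaths  : (t : Tree) → Subset ∣ t ∣ → Maybe Tree
rootPaths* : (ts : List Tree) → Subset (leaves ts) → List Tree

branch : List Tree → Maybe Tree
branch []         = nothing
branch ts@(_ ∷ _) = just (node ts)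

rootPaths (node [])         (inside  ∷ []) = just (node [])
rootPaths (node [])         (outside ∷ []) = nothing
rootPaths (node ts@(_ ∷ _)) L              = branch (rootPaths* ts L)

rootPaths* []       L = []
rootPaths* (t ∷ ts) L =
  List.fromMaybe (rootPaths t (Vec.take ∣ t ∣ L)) ++
  rootPaths* ts (Vec.drop ∣ t ∣ L)

-- In a union of root-to-leaf paths, the most recent common ancestor of the
-- leaves is the first vertex, going away from the root, whose outdegree is
-- not 1.
atMRCA : Tree → Tree
atMRCA (node (t ∷ [])) = atMRCA t
atMRCA t               = t

suppress  : Tree → Tree
suppress* : List Tree → List Tree

smooth : List Tree → Tree
smooth (t ∷ []) = t
smooth ts       = node ts

suppress (node ts) = smooth (suppress* ts)

suppress* []       = []
suppress* (t ∷ ts) = suppress t ∷ suppress* ts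

induced : (t : Tree) → Subset ∣ t ∣ → Maybe Tree
induced t L = Maybe.map (suppress ∘ atMRCA) (rootPaths t L)

subsets : ∀ n → List (Subset n)
subsets zero    = [] ∷ []
subsets (suc n) = map (inside ∷_) (subsets n) ++ map (outside ∷_) (subsets n)

Induces : (s t : Tree) → Subset ∣ t ∣ → Set
Induces s t L = MAny.Any (_≅ s) (induced t L)

induces? : ∀ s t L → Dec (Induces s t L)
induces? s t L = MAny.dec (_≅? s) (induced t L)

c : Tree → Tree → ℕ
c s t = length (filter (induces? s t) (subsets ∣ t ∣))

infixl 7 _÷_

-- With the convention  m ÷ 0 = 0.
_÷_ : ℕ → ℕ → ℚ
m ÷ zero  = 0ℚ
m ÷ suc n = ℤ.+ m ℚ./ suc n

-- If ∣ t ∣ < ∣ s ∣ then the binomial coefficient vanishes, and γ s t = 0.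
γ : Tree → Tree → ℚ
γ s t = c s t ÷ (∣ t ∣ C ∣ s ∣)

topological?  : ∀ t → Dec (Topological t)
topological*? : ∀ ts → Dec (All Topological ts)

topological? (node [])         = yes leaf
topological? (node ts@(_ ∷ _)) =
  map′ (λ (p , q) → node p q) (λ { (node p q) → p , q })
       ((2 ℕ.≤? length ts) ×-dec topological*? ts)

topological*? []       = yes []
topological*? (t ∷ ts) =
  map′ (λ (p , q) → p ∷ q) (λ { (p ∷ q) → p , q })
       (topological? t ×-dec topological*? ts)

listsUpTo : ∀ {A : Set} → ℕ → List A → List (List A)
listsUpTo zero    xs = [] ∷ []
listsUpTo (suc w) xs = [] ∷ cartesianProductWith _∷_ xs (listsUpTo w xs)

-- The trees with at most h levels in which all outdegrees are at most w.
boundedTrees : (w h : ℕ) → List Tree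
boundedTrees w zero    = []
boundedTrees w (suc h) = map node (listsUpTo w (boundedTrees w h))

-- Complete, by ∈-topologicalTrees⁺ below: in a topological tree with n leaves
-- neither the number of levels nor any outdegree exceeds n.
topologicalTrees : ℕ → List Tree
topologicalTrees n =
  filter (λ t → topological? t ×-dec (∣ t ∣ ℕ.≟ n)) (boundedTrees n n)

open Data.List.Extrema (DecTotalOrder.totalOrder ℚ.≤-decTotalOrder)
  using (max; xs≤max; argmax-sel)

-- Densities are nonnegative, so the default value 0 only matters if there
-- are no trees at all, that is, for n = 0; see maxγ-attained and γ≤maxγ.
maxγ : Tree → ℕ → ℚ
maxγ s n = max 0ℚ (map (γ s) (topologicalTrees n))

private
  ∣t∣>0 : ∀ t → 1 ≤ ∣ t ∣
  ∣t∣>0 (node [])       = s≤s z≤n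
  ∣t∣>0 (node (t ∷ ts)) = ℕ.≤-trans (∣t∣>0 t) (ℕ.m≤m+n ∣ t ∣ (leaves ts))

  length≤leaves : ∀ ts → length ts ≤ leaves ts
  length≤leaves []       = z≤n
  length≤leaves (t ∷ ts) = ℕ.+-mono-≤ (∣t∣>0 t) (length≤leaves ts)

  length≤∣∣ : ∀ ts → length ts ≤ ∣ node ts ∣
  length≤∣∣ []           = z≤n
  length≤∣∣ ts@(_ ∷ _) = length≤leaves ts

  child-size : ∀ {t} ts → t ∈ ts → ∣ t ∣ + length ts ≤ suc (leaves ts)
  child-size {t} (_ ∷ ts) (here ≡.refl) = begin
    ∣ t ∣ + suc (length ts)  ≡⟨ ℕ.+-suc ∣ t ∣ (length ts) ⟩
    suc (∣ t ∣ + length ts)  ≤⟨ s≤s (ℕ.+-monoʳ-≤ ∣ t ∣ (length≤leaves ts)) ⟩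
    suc (∣ t ∣ + leaves ts)  ∎
    where open ℕ.≤-Reasoning
  child-size {t} (u ∷ ts) (there t∈ts) = begin
    ∣ t ∣ + suc (length ts)  ≡⟨ ℕ.+-suc ∣ t ∣ (length ts) ⟩
    1 + (∣ t ∣ + length ts)  ≤⟨ ℕ.+-mono-≤ (∣t∣>0 u) (child-size ts t∈ts) ⟩
    ∣ u ∣ + suc (leaves ts)  ≡⟨ ℕ.+-suc ∣ u ∣ (leaves ts) ⟩
    suc (∣ u ∣ + leaves ts)  ∎
    where open ℕ.≤-Reasoning

  child≤ : ∀ {t ts h} → 2 ≤ length ts → t ∈ ts → ∣ node ts ∣ ≤ suc h → ∣ t ∣ ≤ h
  child≤ {t} {ts@(_ ∷ _)} {h} 2≤ t∈ts p = ℕ.+-cancelʳ-≤ 2 ∣ t ∣ h (begin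
    ∣ t ∣ + 2          ≤⟨ ℕ.+-monoʳ-≤ ∣ t ∣ 2≤ ⟩
    ∣ t ∣ + length ts  ≤⟨ child-size ts t∈ts ⟩
    suc (leaves ts)    ≤⟨ s≤s p ⟩
    2 + h              ≡⟨ ℕ.+-comm 2 h ⟩
    h + 2              ∎)
    where open ℕ.≤-Reasoning

  ∈-listsUpTo : ∀ {A : Set} w {xs : List A} {ys} →
                All (_∈ xs) ys → length ys ≤ w → ys ∈ listsUpTo w xs
  ∈-listsUpTo zero    []         _       = here ≡.refl
  ∈-listsUpTo (suc w) []         _       = here ≡.refl
  ∈-listsUpTo (suc w) (y∈ ∷ ys∈) (s≤s p) =
    there (∈-cartesianProductWith⁺ _∷_ y∈ (∈-listsUpTo w ys∈ p))

  ∈-boundedTrees : ∀ w h {t} → Topological t → ∣ t ∣ ≤ h → ∣ t ∣ ≤ w →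
                   t ∈ boundedTrees w h
  ∈-boundedTrees w zero {t} _ t≤0 _ = ⊥-elim (ℕ.<⇒≱ (∣t∣>0 t) t≤0)
  ∈-boundedTrees w (suc h) leaf _ _ = ∈-map⁺ node (∈-listsUpTo w [] z≤n)
  ∈-boundedTrees w (suc h) (node {ts} 2≤ tops) t≤h t≤w =
    ∈-map⁺ node (∈-listsUpTo w
      (All.tabulate λ t∈ts →
        ∈-boundedTrees w h (All.lookup tops t∈ts) (child≤ 2≤ t∈ts t≤h)
          (ℕ.≤-trans (child≤ 2≤ t∈ts (ℕ.m≤n⇒m≤1+n ℕ.≤-refl)) t≤w))
      (ℕ.≤-trans (length≤∣∣ ts) t≤w))

∈-topologicalTrees⁺ : ∀ {t n} → Topological t → ∣ t ∣ ≡ n → t ∈ topologicalTrees n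
∈-topologicalTrees⁺ {t} top ≡.refl =
  ∈-filter⁺ (λ t → topological? t ×-dec (∣ t ∣ ℕ.≟ _))
    (∈-boundedTrees ∣ t ∣ ∣ t ∣ top ℕ.≤-refl ℕ.≤-refl) (top , ≡.refl)

∈-topologicalTrees⁻ : ∀ {t n} → t ∈ topologicalTrees n → Topological t × ∣ t ∣ ≡ n
∈-topologicalTrees⁻ {n = n} t∈ = proj₂
  (∈-filter⁻ (λ t → topological? t ×-dec (∣ t ∣ ℕ.≟ n)) {xs = boundedTrees n n} t∈)

γ≤maxγ : ∀ s {t n} → Topological t → ∣ t ∣ ≡ n → γ s t ℚ.≤ maxγ s n
γ≤maxγ s top eq =
  All.lookup (xs≤max 0ℚ _) (∈-map⁺ (γ s) (∈-topologicalTrees⁺ top eq))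

private
  0≤÷ : ∀ m n → 0ℚ ℚ.≤ m ÷ n
  0≤÷ m zero    = ℚ.≤-refl
  0≤÷ m (suc n) = ℚ.nonNegative⁻¹ (m ÷ suc n) {{ℚ.normalize-nonNeg m (suc n)}}

  star : ∀ n → 1 ≤ n → ∃ λ t → Topological t × ∣ t ∣ ≡ n
  star 1             _ = node [] , leaf , ≡.refl
  star (suc (suc n)) _ =
    node (copies (2 + n)) ,
    node (s≤s (s≤s z≤n)) (Allₚ.replicate⁺ (2 + n) leaf) ,
    size (2 + n)
    where
    copies : ℕ → List Tree
    copies n = replicate n (node [])
    size : ∀ n → leaves (copies n) ≡ n
    size zero    = ≡.refl
    size (suc n) = ≡.cong suc (size n)

maxγ-attained : ∀ s n → 1 ≤ n →
                ∃ λ t → Topological t × ∣ t ∣ ≡ n × γ s t ≡ maxγ s n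
maxγ-attained s n 1≤n
  with argmax-sel (λ q → q) 0ℚ (map (γ s) (topologicalTrees n))
... | inj₁ max≡0 =
  let t , top , eq = star n 1≤n in
  t , top , eq , ℚ.≤-antisym (γ≤maxγ s top eq)
    (ℚ.≤-trans (ℚ.≤-reflexive max≡0) (0≤÷ (c s t) (∣ t ∣ C ∣ s ∣)))
... | inj₂ max∈ =
  let t , t∈ , eq = ∈-map⁻ (γ s) max∈
      top , size  = ∈-topologicalTrees⁻ t∈
  in t , top , size , ≡.sym eq

IsCauchy : (ℕ → ℚ) → Set
IsCauchy a = ∀ ε → 0ℚ ℚ.< ε →
  ∃ λ N → ∀ m n → N ≤ m → N ≤ n → ℚ.∣ a m ℚ.- a n ∣ ℚ.≤ ε

record ℝ : Set where
  constructor mkℝ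
  field
    seq    : ℕ → ℚ
    cauchy : IsCauchy seq

open ℝ public

infix 4 _≤ᵣ_
infixl 6 _-ᵣ_

_≤ᵣ_ : ℝ → ℝ → Set
x ≤ᵣ y = ∀ ε → 0ℚ ℚ.< ε → ∃ λ N → ∀ n → N ≤ n → seq x n ℚ.≤ seq y n ℚ.+ ε

fromℚ : ℚ → ℝ
fromℚ q = mkℝ (λ _ → q) λ ε 0<ε → 0 , λ _ _ _ _ →
  ℚ.≤-trans (ℚ.≤-reflexive (≡.cong ℚ.∣_∣ (ℚ.+-inverseʳ q))) (ℚ.<⇒≤ 0<ε)

private
  0<½ε : ∀ {ε} → 0ℚ ℚ.< ε → 0ℚ ℚ.< ½ ℚ.* ε
  0<½ε {ε} 0<ε = ≡.subst (ℚ._< ½ ℚ.* ε) (ℚ.*-zeroʳ ½) (ℚ.*-monoʳ-<-pos ½ 0<ε)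

  ½ε+½ε : ∀ ε → ½ ℚ.* ε ℚ.+ ½ ℚ.* ε ≡ ε
  ½ε+½ε ε = ≡.trans (≡.sym (ℚ.*-distribʳ-+ ε ½ ½)) (ℚ.*-identityˡ ε)

  rearrange : ∀ a b c d → (a ℚ.- b) ℚ.- (c ℚ.- d) ≡ (a ℚ.- c) ℚ.- (b ℚ.- d)
  rearrange = solve 4 (λ a b c d →
    (a :- b) :- (c :- d) := (a :- c) :- (b :- d)) ≡.refl
    where open +-*-Solver

_-ᵣ_ : ℝ → ℝ → ℝ
x -ᵣ y = mkℝ (λ n → seq x n ℚ.- seq y n) λ ε 0<ε →
  let M , p = cauchy x (½ ℚ.* ε) (0<½ε 0<ε)
      N , q = cauchy y (½ ℚ.* ε) (0<½ε 0<ε)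
      open ℚ.≤-Reasoning
  in M ⊔ N , λ m n m≥ n≥ → begin
    ℚ.∣ (seq x m ℚ.- seq y m) ℚ.- (seq x n ℚ.- seq y n) ∣
      ≡⟨ ≡.cong ℚ.∣_∣ (rearrange (seq x m) (seq y m) (seq x n) (seq y n)) ⟩
    ℚ.∣ (seq x m ℚ.- seq x n) ℚ.- (seq y m ℚ.- seq y n) ∣
      ≤⟨ ℚ.∣p-q∣≤∣p∣+∣q∣ (seq x m ℚ.- seq x n) (seq y m ℚ.- seq y n) ⟩
    ℚ.∣ seq x m ℚ.- seq x n ∣ ℚ.+ ℚ.∣ seq y m ℚ.- seq y n ∣
      ≤⟨ ℚ.+-mono-≤ (p m n (ℕ.m⊔n≤o⇒m≤o M N m≥) (ℕ.m⊔n≤o⇒m≤o M N n≥))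
                    (q m n (ℕ.m⊔n≤o⇒n≤o M N m≥) (ℕ.m⊔n≤o⇒n≤o M N n≥)) ⟩
    ½ ℚ.* ε ℚ.+ ½ ℚ.* ε
      ≡⟨ ½ε+½ε ε ⟩
    ε ∎

private
  p-q≤ : ∀ p q → ℚ.∣ p ∣ ℚ.- ℚ.∣ q ∣ ℚ.≤ ℚ.∣ p ℚ.- q ∣
  p-q≤ p q = begin
    ℚ.∣ p ∣ ℚ.- ℚ.∣ q ∣
      ≡⟨ ≡.cong (λ r → ℚ.∣ r ∣ ℚ.- ℚ.∣ q ∣) (cancel₁ p q) ⟨
    ℚ.∣ (p ℚ.- q) ℚ.+ q ∣ ℚ.- ℚ.∣ q ∣
      ≤⟨ ℚ.+-monoˡ-≤ (ℚ.- ℚ.∣ q ∣) (ℚ.∣p+q∣≤∣p∣+∣q∣ (p ℚ.- q) q) ⟩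
    ℚ.∣ p ℚ.- q ∣ ℚ.+ ℚ.∣ q ∣ ℚ.- ℚ.∣ q ∣
      ≡⟨ cancel₂ ℚ.∣ p ℚ.- q ∣ ℚ.∣ q ∣ ⟩
    ℚ.∣ p ℚ.- q ∣ ∎
    where
    open ℚ.≤-Reasoning
    open +-*-Solver
    cancel₁ : ∀ p q → (p ℚ.- q) ℚ.+ q ≡ p
    cancel₁ = solve 2 (λ p q → (p :- q) :+ q := p) ≡.refl
    cancel₂ : ∀ p q → p ℚ.+ q ℚ.- q ≡ p
    cancel₂ = solve 2 (λ p q → p :+ q :- q := p) ≡.refl

  neg-minus : ∀ p q → ℚ.- (p ℚ.- q) ≡ q ℚ.- p
  neg-minus = solve 2 (λ p q → :- (p :- q) := q :- p) ≡.refl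
    where open +-*-Solver

  ∣∣p∣-∣q∣∣≤∣p-q∣ : ∀ p q → ℚ.∣ ℚ.∣ p ∣ ℚ.- ℚ.∣ q ∣ ∣ ℚ.≤ ℚ.∣ p ℚ.- q ∣
  ∣∣p∣-∣q∣∣≤∣p-q∣ p q with ℚ.∣p∣≡p∨∣p∣≡-p (ℚ.∣ p ∣ ℚ.- ℚ.∣ q ∣)
  ... | inj₁ eq = ℚ.≤-trans (ℚ.≤-reflexive eq) (p-q≤ p q)
  ... | inj₂ eq = begin
    ℚ.∣ ℚ.∣ p ∣ ℚ.- ℚ.∣ q ∣ ∣  ≡⟨ eq ⟩
    ℚ.- (ℚ.∣ p ∣ ℚ.- ℚ.∣ q ∣)  ≡⟨ neg-minus ℚ.∣ p ∣ ℚ.∣ q ∣ ⟩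
    ℚ.∣ q ∣ ℚ.- ℚ.∣ p ∣        ≤⟨ p-q≤ q p ⟩
    ℚ.∣ q ℚ.- p ∣              ≡⟨ ≡.cong ℚ.∣_∣ (neg-minus p q) ⟨
    ℚ.∣ ℚ.- (p ℚ.- q) ∣        ≡⟨ ℚ.∣-p∣≡∣p∣ (p ℚ.- q) ⟩
    ℚ.∣ p ℚ.- q ∣              ∎
    where open ℚ.≤-Reasoning

abs : ℝ → ℝ
abs x = mkℝ (λ n → ℚ.∣ seq x n ∣) λ ε 0<ε →
  let N , p = cauchy x ε 0<ε
  in N , λ m n m≥ n≥ →
    ℚ.≤-trans (∣∣p∣-∣q∣∣≤∣p-q∣ (seq x m) (seq x n)) (p m n m≥ n≥)

IsSup : (ℕ → ℝ) → ℝ → Set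
IsSup a s = (∀ n → a n ≤ᵣ s) × (∀ u → (∀ n → a n ≤ᵣ u) → s ≤ᵣ u)

IsInf : (ℕ → ℝ) → ℝ → Set
IsInf a s = (∀ n → s ≤ᵣ a n) × (∀ l → (∀ n → l ≤ᵣ a n) → l ≤ᵣ s)

-- limsup a = inf_n sup_{m ≥ n} a_m
IsLimsup : (ℕ → ℝ) → ℝ → Set
IsLimsup a x = Σ (ℕ → ℝ) λ s →
  (∀ n → IsSup (λ i → a (n + i)) (s n)) × IsInf s x

IsLimit : (ℕ → ℝ) → ℝ → Set
IsLimit a x = ∀ ε → 0ℚ ℚ.< ε →
  ∃ λ N → ∀ n → N ≤ n → abs (a n -ᵣ x) ≤ᵣ fromℚ ε

maxγᵣ : Tree → ℕ → ℝ
maxγᵣ s n = fromℚ (maxγ s n)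

-- The terms with n < ∣ s ∣ do not affect the limit superior.
IsInducibility : Tree → ℝ → Set
IsInducibility s = IsLimsup (maxγᵣ s)

{-# OPTIONS --safe #-}
-- Write γₙ for the maximal density of S among trees with n leaves, and k = ∣ S ∣.
-- Averaging c(S, T − v) over all leaves v of T shows that γₙ decreases for
-- n ≥ k. Conversely, replacing every leaf of an optimal tree with n leaves by
-- a star with m leaves multiplies the number of copies of S by at least m ^ k,
-- whence γₙₘ ≥ γₙ · m ^ k · C(n, k) / C(nm, k) ≥ γₙ − k (k − 1) / n. By
-- monotonicity γⱼ ≥ γₙ − k (k − 1) / n for all j ≥ n, so the sequence is
-- Cauchy with an explicit rate, and its limit is J(S).
module Submission where

open import Data.Bool.Base using (if_then_else_)
open import Data.Fin.Subset using (Subset; inside; outside)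
import Data.Integer.Base as ℤ
import Data.Integer.Properties as ℤ
open import Data.List.Base as List using (List; []; _∷_; _++_; length; filter; map; replicate)
open import Data.List.Properties using (map-++; map-∘)
open import Data.List.Relation.Binary.Permutation.Homogeneous as Perm using (Permutation)
open import Data.List.Relation.Binary.Pointwise.Base using (Pointwise; []; _∷_)
open import Data.List.Relation.Unary.All using (All; []; _∷_)
import Data.List.Relation.Unary.All.Properties as All
open import Data.Maybe.Base as Maybe using (Maybe; just; nothing; maybe′)
open import Data.Maybe.Relation.Unary.All as MAll using (just; nothing)
open import Data.Maybe.Relation.Unary.Any as MAny using (just)
open import Data.Nat.Base
open import Data.Nat.Combinatorics using (_C_; nCk+nC[k+1]≡[n+1]C[k+1]; nC1≡n)
open import Data.Nat.Combinatorics.Specification using (k>n⇒nCk≡0)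
open import Data.Nat.ListAction using (sum)
open import Data.Nat.ListAction.Properties using (sum-++)
open import Data.Nat.Properties
open import Data.Nat.Solver using (module +-*-Solver)
open import Data.Product.Base using (∃; _×_; _,_; proj₁; proj₂)
open import Data.Rational.Base as ℚ using (ℚ; 0ℚ; ½; mkℚ)
import Data.Rational.Properties as ℚ
open import Data.Rational.Solver using () renaming (module +-*-Solver to ℚ-Solver)
open import Data.Rational.Unnormalised.Base as ℚᵘ using (mkℚᵘ)
import Data.Rational.Unnormalised.Properties as ℚᵘ
open import Data.Sum.Base using (inj₁; inj₂)
open import Data.Vec.Base as Vec using ([]; _∷_)
open import Function.Base using (_∘_; const)
open import Relation.Binary.PropositionalEquality
open import Relation.Nullary.Decidable using (Dec; yes; no; does)
open import Relation.Nullary.Negation using (contradiction)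
open import Relation.Unary using (Decidable)
open import Defs

open +-*-Solver using (solve; _:+_; _:*_; _:=_; con)
open ℚ-Solver using ()
  renaming (solve to ℚ-solve; _:+_ to _⊞_; _:-_ to _⊟_; _:=_ to _⩵_; :-_ to ⊟_)

-- Leaf sets are subsets of a left-to-right numbering, and both deleting a leaf and replacing leaves
-- by stars renumber everything. So all counting is done with sums of F(T_L) over leaf sets L,
-- computed by recursion on the tree; c(S, T) is the case where F is the indicator of a copy of S,
-- and after `c≡sumInduced` the numbering no longer occurs. The weight F has to be arbitrary because
-- on entering a child it becomes a sum over the leaf sets of the siblings, which is not an
-- indicator any more. The loss k (k - 1) / n in the blow-up does not depend on m: the factor m ^ k
-- · C(n, k) / C(nm, k) is at least n (n - 1) ⋯ (n - k + 1) / n ^ k. Hence m may be chosen so large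
-- that nm exceeds any given j. The explicit rate is also what makes J(S) exist: a real is a Cauchy
-- sequence of rationals, and a bounded monotone sequence need not constructively have a modulus.

private
  variable
    A : Set

-- Sums over sets of leaves

𝟙 : {P : Set} → Dec P → ℕ
𝟙 P? = if does P? then 1 else 0

-- Recursive, rather than a `sum` over the list `subsets n`, so that a set of leaves of a forest
-- splits along its first tree by a plain induction.
sumSubsets : ∀ n → (Subset n → ℕ) → ℕ
sumSubsets zero    f = f []
sumSubsets (suc n) f = sumSubsets n (f ∘ (inside ∷_)) + sumSubsets n (f ∘ (outside ∷_))

sumSubsets-cong : ∀ n {f g : Subset n → ℕ} → (∀ L → f L ≡ g L) →
                  sumSubsets n f ≡ sumSubsets n g
sumSubsets-cong zero    eq = eq []
sumSubsets-cong (suc n) eq =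
  cong₂ _+_ (sumSubsets-cong n (eq ∘ _)) (sumSubsets-cong n (eq ∘ _))

sumSubsets-++ : ∀ m {n} (f : Subset m → Subset n → ℕ) →
  sumSubsets (m + n) (λ L → f (Vec.take m L) (Vec.drop m L)) ≡
  sumSubsets m (λ L → sumSubsets n (f L))
sumSubsets-++ zero    f = refl
sumSubsets-++ (suc m) f =
  cong₂ _+_ (sumSubsets-++ m (f ∘ (inside ∷_))) (sumSubsets-++ m (f ∘ (outside ∷_)))

sum-subsets : ∀ n (f : Subset n → ℕ) → sum (map f (subsets n)) ≡ sumSubsets n f
sum-subsets zero    f = +-identityʳ (f [])
sum-subsets (suc n) f = begin
  sum (map f (map (inside ∷_) (subsets n) ++ map (outside ∷_) (subsets n)))
    ≡⟨ cong sum (map-++ f (map (inside ∷_) (subsets n)) _) ⟩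
  sum (map f (map (inside ∷_) (subsets n)) ++ map f (map (outside ∷_) (subsets n)))
    ≡⟨ sum-++ (map f (map (inside ∷_) (subsets n))) _ ⟩
  sum (map f (map (inside ∷_) (subsets n))) + sum (map f (map (outside ∷_) (subsets n)))
    ≡⟨ cong₂ (λ xs ys → sum xs + sum ys) (map-∘ (subsets n)) (map-∘ (subsets n)) ⟨
  sum (map (f ∘ (inside ∷_)) (subsets n)) + sum (map (f ∘ (outside ∷_)) (subsets n))
    ≡⟨ cong₂ _+_ (sum-subsets n _) (sum-subsets n _) ⟩
  sumSubsets (suc n) f ∎
  where open ≡-Reasoning

length-filter : ∀ {P : A → Set} (P? : Decidable P) xs →
                length (filter P? xs) ≡ sum (map (λ x → 𝟙 (P? x)) xs)
length-filter P? []       = refl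
length-filter P? (x ∷ xs) with P? x
... | yes _ = cong suc (length-filter P? xs)
... | no  _ = length-filter P? xs

-- What is left of an inner vertex, given the induced trees of the children that meet L: it vanishes
-- if there are none and is suppressed if there is one.
join : List Tree → Maybe Tree
join []           = nothing
join (t ∷ [])     = just t
join ts@(_ ∷ _ ∷ _) = just (node ts)

-- Σ F(T_L) over all sets L of leaves of a tree T, where T_L is the induced
-- tree (nothing if L is empty); for a forest, the induced trees of its
-- components are listed.
sumInduced  : Tree → (Maybe Tree → ℕ) → ℕ
sumInduced* : List Tree → (List Tree → ℕ) → ℕ

sumInduced (node [])         F = F (just (node [])) + F nothing
sumInduced (node ts@(_ ∷ _)) F = sumInduced* ts (F ∘ join)

sumInduced* []       G = G []
sumInduced* (t ∷ ts) G =
  sumInduced t λ m → sumInduced* ts λ us → G (List.fromMaybe m ++ us)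

-- The vertices skipped on the way to the most recent common ancestor have outdegree 1, so
-- `suppress` erases them anyway.
suppress-atMRCA : ∀ t → suppress (atMRCA t) ≡ suppress t
suppress-atMRCA (node [])          = refl
suppress-atMRCA (node (t ∷ []))    = suppress-atMRCA t
suppress-atMRCA (node (_ ∷ _ ∷ _)) = refl

suppress*-++ : ∀ ts us → suppress* (ts ++ us) ≡ suppress* ts ++ suppress* us
suppress*-++ []       us = refl
suppress*-++ (t ∷ ts) us = cong (suppress t ∷_) (suppress*-++ ts us)

suppress*-fromMaybe : ∀ m →
  suppress* (List.fromMaybe m) ≡ List.fromMaybe (Maybe.map suppress m)
suppress*-fromMaybe (just _) = refl
suppress*-fromMaybe nothing  = refl

suppress-branch : ∀ ts → Maybe.map suppress (branch ts) ≡ join (suppress* ts)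
suppress-branch []          = refl
suppress-branch (_ ∷ [])    = refl
suppress-branch (_ ∷ _ ∷ _) = refl

sumSubsets-rootPaths : ∀ t F →
  sumSubsets (∣ t ∣) (λ L → F (Maybe.map suppress (rootPaths t L))) ≡ sumInduced t F
sumSubsets-rootPaths* : ∀ ts G →
  sumSubsets (leaves ts) (λ L → G (suppress* (rootPaths* ts L))) ≡ sumInduced* ts G

sumSubsets-rootPaths (node [])         F = refl
sumSubsets-rootPaths (node ts@(_ ∷ _)) F = trans
  (sumSubsets-cong (leaves ts) λ L → cong F (suppress-branch (rootPaths* ts L)))
  (sumSubsets-rootPaths* ts (F ∘ join))

sumSubsets-rootPaths* []       G = refl
sumSubsets-rootPaths* (t ∷ ts) G = begin
  sumSubsets (∣ t ∣ + leaves ts) (λ L → G (suppress* (rootPaths* (t ∷ ts) L)))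
    ≡⟨ sumSubsets-cong (∣ t ∣ + leaves ts)
         (λ L → cong G (distr (Vec.take (∣ t ∣) L) (Vec.drop (∣ t ∣) L))) ⟩
  sumSubsets (∣ t ∣ + leaves ts) (λ L → H (Vec.take (∣ t ∣) L) (Vec.drop (∣ t ∣) L))
    ≡⟨ sumSubsets-++ (∣ t ∣) H ⟩
  sumSubsets (∣ t ∣) (λ L → sumSubsets (leaves ts) (H L))
    ≡⟨ sumSubsets-cong (∣ t ∣) (λ L →
         sumSubsets-rootPaths* ts (λ us → G (List.fromMaybe (Maybe.map suppress (rootPaths t L)) ++ us))) ⟩
  _ ≡⟨ sumSubsets-rootPaths t (λ m → sumInduced* ts λ us → G (List.fromMaybe m ++ us)) ⟩
  sumInduced* (t ∷ ts) G ∎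
  where
  open ≡-Reasoning
  H : Subset ∣ t ∣ → Subset (leaves ts) → ℕ
  H L L′ = G (List.fromMaybe (Maybe.map suppress (rootPaths t L)) ++ suppress* (rootPaths* ts L′))
  distr : ∀ L L′ →
    suppress* (List.fromMaybe (rootPaths t L) ++ rootPaths* ts L′) ≡
    List.fromMaybe (Maybe.map suppress (rootPaths t L)) ++ suppress* (rootPaths* ts L′)
  distr L L′ = trans (suppress*-++ (List.fromMaybe (rootPaths t L)) _)
    (cong (_++ suppress* (rootPaths* ts L′)) (suppress*-fromMaybe (rootPaths t L)))

copies? : ∀ s m → Dec (MAny.Any (_≅ s) m)
copies? s = MAny.dec (_≅? s)

c≡sumInduced : ∀ s t → c s t ≡ sumInduced t (λ m → 𝟙 (copies? s m))
c≡sumInduced s t = begin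
  c s t
    ≡⟨ length-filter (induces? s t) (subsets (∣ t ∣)) ⟩
  sum (map (λ L → 𝟙 (induces? s t L)) (subsets (∣ t ∣)))
    ≡⟨ sum-subsets (∣ t ∣) _ ⟩
  sumSubsets (∣ t ∣) (λ L → 𝟙 (copies? s (induced t L)))
    ≡⟨ sumSubsets-cong (∣ t ∣) (λ L → cong (λ m → 𝟙 (copies? s m)) (lift (rootPaths t L))) ⟩
  sumSubsets (∣ t ∣) (λ L → 𝟙 (copies? s (Maybe.map suppress (rootPaths t L))))
    ≡⟨ sumSubsets-rootPaths t _ ⟩
  sumInduced t (λ m → 𝟙 (copies? s m)) ∎
  where
  open ≡-Reasoning
  lift : ∀ m → Maybe.map (suppress ∘ atMRCA) m ≡ Maybe.map suppress m
  lift (just t) = cong just (suppress-atMRCA t)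
  lift nothing  = refl

-- Every componentwise additive relation passes to sums; this yields
-- congruence, monotonicity and linearity of sumInduced.
module _ (_∼_,_ : ℕ → ℕ → ℕ → Set)
  (_⊕_ : ∀ {a b x y z w} → a ∼ x , y → b ∼ z , w → (a + b) ∼ (x + z) , (y + w)) where

  sumInduced-rel : ∀ t {F G H} → (∀ m → F m ∼ G m , H m) →
                   sumInduced t F ∼ sumInduced t G , sumInduced t H
  sumInduced*-rel : ∀ ts {F G H} → (∀ us → F us ∼ G us , H us) →
                    sumInduced* ts F ∼ sumInduced* ts G , sumInduced* ts H

  sumInduced-rel (node [])         r = r _ ⊕ r _
  sumInduced-rel (node ts@(_ ∷ _)) r = sumInduced*-rel ts (r ∘ join)

  sumInduced*-rel []       r = r []
  sumInduced*-rel (t ∷ ts) r =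
    sumInduced-rel t λ m → sumInduced*-rel ts λ us → r (List.fromMaybe m ++ us)

sumInduced-cong : ∀ t {F G} → (∀ m → F m ≡ G m) → sumInduced t F ≡ sumInduced t G
sumInduced-cong t {G = G} e = sumInduced-rel (λ a x _ → a ≡ x) (cong₂ _+_) t {H = G} e

sumInduced*-cong : ∀ ts {F G} → (∀ us → F us ≡ G us) → sumInduced* ts F ≡ sumInduced* ts G
sumInduced*-cong ts {G = G} e = sumInduced*-rel (λ a x _ → a ≡ x) (cong₂ _+_) ts {H = G} e

sumInduced-mono : ∀ t {F G} → (∀ m → F m ≤ G m) → sumInduced t F ≤ sumInduced t G
sumInduced-mono t {G = G} e = sumInduced-rel (λ a x _ → a ≤ x) +-mono-≤ t {H = G} e

private
  +-interchange : ∀ x y z w → (x + y) + (z + w) ≡ (x + z) + (y + w)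
  +-interchange = solve 4 (λ x y z w → (x :+ y) :+ (z :+ w) := (x :+ z) :+ (y :+ w)) refl

sumInduced-+ : ∀ t F G → sumInduced t (λ m → F m + G m) ≡ sumInduced t F + sumInduced t G
sumInduced-+ t F G = sumInduced-rel (λ a x y → a ≡ x + y)
  (λ {_} {_} {x} {y} {z} {w} p q → trans (cong₂ _+_ p q) (+-interchange x y z w))
  t {G = F} {H = G} (λ _ → refl)

module _ (k : ℕ) where
  private
    scale : ℕ → ℕ → ℕ → Set
    scale a x _ = a ≡ k * x
    scale-+ : ∀ {a b x z} → a ≡ k * x → b ≡ k * z → a + b ≡ k * (x + z)
    scale-+ {x = x} {z} p q = trans (cong₂ _+_ p q) (sym (*-distribˡ-+ k x z))

  sumInduced-* : ∀ t F → sumInduced t (λ m → k * F m) ≡ k * sumInduced t F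
  sumInduced-* t F = sumInduced-rel scale scale-+ t {H = F} (λ _ → refl)

  sumInduced*-* : ∀ ts G → sumInduced* ts (λ us → k * G us) ≡ k * sumInduced* ts G
  sumInduced*-* ts G = sumInduced*-rel scale scale-+ ts {H = G} (λ _ → refl)

size : Maybe Tree → ℕ
size = maybe′ ∣_∣ 0

leaves-fromMaybe : ∀ m us → leaves (List.fromMaybe m ++ us) ≡ size m + leaves us
leaves-fromMaybe (just _) us = refl
leaves-fromMaybe nothing  us = refl

size-join : ∀ ts → size (join ts) ≡ leaves ts
size-join []          = refl
size-join (t ∷ [])    = sym (+-identityʳ ∣ t ∣)
size-join (_ ∷ _ ∷ _) = refl

-- Deleting a leaf

-- Σ F(T − v) over all leaves v of T.
sumDeletions  : Tree → (Maybe Tree → ℕ) → ℕ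
sumDeletions* : List Tree → (List Tree → ℕ) → ℕ

sumDeletions (node [])         F = F nothing
sumDeletions (node ts@(_ ∷ _)) F = sumDeletions* ts (F ∘ join)

sumDeletions* []       G = 0
sumDeletions* (t ∷ ts) G =
  sumDeletions t (λ m → G (List.fromMaybe m ++ ts)) + sumDeletions* ts (G ∘ (t ∷_))

sumDeletions-cong : ∀ t {F G} → (∀ m → F m ≡ G m) → sumDeletions t F ≡ sumDeletions t G
sumDeletions*-cong : ∀ ts {F G} → (∀ us → F us ≡ G us) → sumDeletions* ts F ≡ sumDeletions* ts G
sumDeletions-cong (node [])         e = e nothing
sumDeletions-cong (node ts@(_ ∷ _)) e = sumDeletions*-cong ts (e ∘ join)
sumDeletions*-cong []       e = refl
sumDeletions*-cong (t ∷ ts) e =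
  cong₂ _+_ (sumDeletions-cong t λ m → e (List.fromMaybe m ++ ts)) (sumDeletions*-cong ts (e ∘ (t ∷_)))

sumInduced-0 : ∀ t → sumInduced t (const 0) ≡ 0
sumInduced-0 t = sumInduced-* 0 t (const 0)

-- Needed in a forest, where the deleted leaf may lie in another component than the part of L being
-- summed over.
sumDeletions-swap : ∀ u t (H : Maybe Tree → Maybe Tree → ℕ) →
  sumDeletions t (λ m → sumInduced u (H m)) ≡ sumInduced u (λ x → sumDeletions t (λ m → H m x))
sumDeletions*-swap : ∀ u ts (H : List Tree → Maybe Tree → ℕ) →
  sumDeletions* ts (λ us → sumInduced u (H us)) ≡ sumInduced u (λ x → sumDeletions* ts (λ us → H us x))

sumDeletions-swap u (node [])         H = refl
sumDeletions-swap u (node ts@(_ ∷ _)) H = sumDeletions*-swap u ts (H ∘ join)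

sumDeletions*-swap u []       H = sym (sumInduced-0 u)
sumDeletions*-swap u (t ∷ ts) H = trans
  (cong₂ _+_ (sumDeletions-swap u t λ m → H (List.fromMaybe m ++ ts))
             (sumDeletions*-swap u ts (H ∘ (t ∷_))))
  (sym (sumInduced-+ u _ _))

-- Deleting the leaf of a one-vertex tree leaves `nothing`, whose only leaf set is the empty one.
sumInduced? : Maybe Tree → (Maybe Tree → ℕ) → ℕ
sumInduced? (just t) F = sumInduced t F
sumInduced? nothing  F = F nothing

sumInduced?-join : ∀ us F → sumInduced? (join us) F ≡ sumInduced* us (F ∘ join)
sumInduced?-join []          F = refl
sumInduced?-join (u ∷ [])    F = sumInduced-cong u λ where
  (just _) → refl
  nothing  → refl
sumInduced?-join (_ ∷ _ ∷ _) F = refl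

sumInduced*-fromMaybe : ∀ m us G →
  sumInduced* (List.fromMaybe m ++ us) G ≡
  sumInduced? m (λ x → sumInduced* us λ vs → G (List.fromMaybe x ++ vs))
sumInduced*-fromMaybe (just _) us G = refl
sumInduced*-fromMaybe nothing  us G = refl

-- Double counting of the pairs (v , L) with v ∉ L: a set L of leaves misses
-- ∣ t ∣ ∸ ∣ L ∣ leaves v. The subtraction is moved to the other side.
sumDeletions-sumInduced : ∀ t F →
  sumDeletions t (λ m → sumInduced? m F) + sumInduced t (λ m → size m * F m) ≡
  ∣ t ∣ * sumInduced t F
sumDeletions*-sumInduced* : ∀ ts G →
  sumDeletions* ts (λ us → sumInduced* us G) + sumInduced* ts (λ us → leaves us * G us) ≡
  leaves ts * sumInduced* ts G

sumDeletions-sumInduced (node []) F =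
  solve 2 (λ x y → y :+ ((x :+ con 0) :+ con 0) := (x :+ y) :+ con 0) refl
    (F (just (node []))) (F nothing)
sumDeletions-sumInduced (node ts@(_ ∷ _)) F = trans
  (cong₂ _+_ (sumDeletions*-cong ts λ us → sumInduced?-join us F)
             (sumInduced*-cong ts λ us → cong (_* F (join us)) (size-join us)))
  (sumDeletions*-sumInduced* ts (F ∘ join))

sumDeletions*-sumInduced* []       G = refl
sumDeletions*-sumInduced* (t ∷ ts) G = begin
  sumDeletions* (t ∷ ts) (λ us → sumInduced* us G) + sumInduced* (t ∷ ts) (λ us → leaves us * G us)
    ≡⟨ cong₂ _+_ (cong₂ _+_ (sumDeletions-cong t λ m → sumInduced*-fromMaybe m ts G)
                            (sumDeletions*-swap t ts λ us x → sumInduced* us (g x)))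
                 (trans (sumInduced-cong t split) (sumInduced-+ t _ _)) ⟩
  -- `D₁` and `I₁` collect the deletions and the size weight in `t`, `D₂` and `I₂` those in `ts`;
  -- after regrouping, each pair is an induction hypothesis.
  (D₁ + D₂) + (I₁ + I₂)
    ≡⟨ +-interchange D₁ D₂ I₁ I₂ ⟩
  (D₁ + I₁) + (D₂ + I₂)
    ≡⟨ cong₂ _+_ (sumDeletions-sumInduced t F) step ⟩
  ∣ t ∣ * sumInduced t F + leaves ts * sumInduced t F
    ≡⟨ *-distribʳ-+ (sumInduced t F) ∣ t ∣ (leaves ts) ⟨
  (∣ t ∣ + leaves ts) * sumInduced t F ∎
  where
  open ≡-Reasoning
  g : Maybe Tree → List Tree → ℕ
  g x us = G (List.fromMaybe x ++ us)
  F : Maybe Tree → ℕ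
  F x = sumInduced* ts (g x)
  D₁ = sumDeletions t λ m → sumInduced? m F
  D₂ = sumInduced t λ x → sumDeletions* ts λ us → sumInduced* us (g x)
  I₁ = sumInduced t λ x → size x * F x
  I₂ = sumInduced t λ x → sumInduced* ts λ us → leaves us * g x us
  split : ∀ x → sumInduced* ts (λ us → leaves (List.fromMaybe x ++ us) * g x us) ≡
                size x * F x + sumInduced* ts (λ us → leaves us * g x us)
  split x = sumInduced*-rel (λ a b d → a ≡ size x * b + d)
    (λ {_} {_} {b} {d} {b′} {d′} p q → trans (cong₂ _+_ p q)
      (solve 5 (λ n b d b′ d′ → (n :* b :+ d) :+ (n :* b′ :+ d′) := n :* (b :+ b′) :+ (d :+ d′))
        refl (size x) b d b′ d′))
    ts λ us → trans (cong (_* g x us) (leaves-fromMaybe x us)) (*-distribʳ-+ (g x us) (size x) (leaves us))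
  step : D₂ + I₂ ≡ leaves ts * sumInduced t F
  step = begin
    D₂ + I₂ ≡⟨ sumInduced-+ t _ _ ⟨
    _       ≡⟨ sumInduced-cong t (λ x → sumDeletions*-sumInduced* ts (g x)) ⟩
    _       ≡⟨ sumInduced-* (leaves ts) t F ⟩
    leaves ts * sumInduced t F ∎

join-topological : ∀ {us} → All Topological us → MAll.All Topological (join us)
join-topological []               = nothing
join-topological (p ∷ [])         = just p
join-topological ps@(_ ∷ _ ∷ _)   = just (node (s≤s (s≤s z≤n)) ps)

fromMaybe-All : ∀ {P : A → Set} {m xs} → MAll.All P m → All P xs → All P (List.fromMaybe m ++ xs)
fromMaybe-All (just p) ps = p ∷ ps
fromMaybe-All nothing  ps = ps

-- The sum has one term per leaf, and `join` suppresses a vertex left with one child, so every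
-- deletion is again topological. The hypothesis is limited to such trees with one leaf fewer, for
-- which a maximal tree can supply `b`.
sumDeletions-bound : ∀ {t} b {F} → Topological t →
  (∀ m → MAll.All Topological m → suc (size m) ≡ ∣ t ∣ → F m ≤ b) →
  sumDeletions t F ≤ ∣ t ∣ * b
sumDeletions*-bound : ∀ {ts} b {G} → All Topological ts →
  (∀ us → All Topological us → suc (leaves us) ≡ leaves ts → G us ≤ b) →
  sumDeletions* ts G ≤ leaves ts * b

sumDeletions-bound b leaf h = ≤-trans (h nothing nothing refl) (m≤m+n b 0)
sumDeletions-bound b (node {ts@(_ ∷ _)} _ tops) h =
  sumDeletions*-bound b tops λ us p eq →
    h (join us) (join-topological p) (trans (cong suc (size-join us)) eq)

sumDeletions*-bound b []                        h = z≤n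
sumDeletions*-bound b {G} (_∷_ {t} {ts} p ps) h = begin
  sumDeletions t (λ m → G (List.fromMaybe m ++ ts)) + sumDeletions* ts (G ∘ (t ∷_))
    ≤⟨ +-mono-≤
         (sumDeletions-bound b p λ m q eq → h _ (fromMaybe-All q ps)
           (trans (cong suc (leaves-fromMaybe m ts)) (cong (_+ leaves ts) eq)))
         (sumDeletions*-bound b ps λ us q eq → h (t ∷ us) (p ∷ q)
           (trans (sym (+-suc ∣ t ∣ (leaves us))) (cong (∣ t ∣ +_) eq))) ⟩
  ∣ t ∣ * b + leaves ts * b
    ≡⟨ *-distribʳ-+ b ∣ t ∣ (leaves ts) ⟨
  (∣ t ∣ + leaves ts) * b ∎
  where open ≤-Reasoning

≅-size    : ∀ {t u} → t ≅ u → ∣ t ∣ ≡ ∣ u ∣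
↭-length  : ∀ {ts us} → Permutation _≅_ ts us → length ts ≡ length us
↭-leaves  : ∀ {ts us} → Permutation _≅_ ts us → leaves ts ≡ leaves us
≋-length  : ∀ {ts us} → Pointwise _≅_ ts us → length ts ≡ length us
≋-leaves  : ∀ {ts us} → Pointwise _≅_ ts us → leaves ts ≡ leaves us

≋-length []       = refl
≋-length (_ ∷ ps) = cong suc (≋-length ps)
↭-length (Perm.refl p)      = ≋-length p
↭-length (Perm.prep _ p)    = cong suc (↭-length p)
↭-length (Perm.swap _ _ p)  = cong (suc ∘ suc) (↭-length p)
↭-length (Perm.trans p q)   = trans (↭-length p) (↭-length q)
≅-size {node []}      {node []}      (node _) = refl
≅-size {node []}      {node (_ ∷ _)} (node p) = contradiction (↭-length p) λ ()
≅-size {node (_ ∷ _)} {node []}      (node p) = contradiction (↭-length p) λ ()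
≅-size {node (_ ∷ _)} {node (_ ∷ _)} (node p) = ↭-leaves p
≋-leaves []       = refl
≋-leaves (p ∷ ps) = cong₂ _+_ (≅-size p) (≋-leaves ps)
↭-leaves (Perm.refl p)     = ≋-leaves p
↭-leaves (Perm.prep e p)   = cong₂ _+_ (≅-size e) (↭-leaves p)
↭-leaves (Perm.trans p q)  = trans (↭-leaves p) (↭-leaves q)
↭-leaves (Perm.swap {x = x} {y} {x′} {y′} d e p) = trans
  (cong₂ _+_ (≅-size d) (cong₂ _+_ (≅-size e) (↭-leaves p)))
  (solve 3 (λ a b l → a :+ (b :+ l) := b :+ (a :+ l)) refl ∣ x′ ∣ ∣ y′ ∣ _)

module _ (s : Tree) where

  private
    F : Maybe Tree → ℕ
    F m = 𝟙 (copies? s m)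

  -- `F` vanishes except on copies of `s`, which all have the same number of leaves. Used with `f`
  -- the identity for deletions and a power for blow-ups.
  copy-size : ∀ m (f : ℕ → ℕ) → f (size m) * F m ≡ f ∣ s ∣ * F m
  copy-size m f with copies? s m
  ... | yes (just p) = cong (λ n → f n * 1) (≅-size p)
  ... | no _         = trans (*-zeroʳ (f (size m))) (sym (*-zeroʳ (f ∣ s ∣)))

  -- Each copy of `s` survives the deletion of exactly ∣ t ∣ - ∣ s ∣ leaves, so (∣ t ∣ - ∣ s ∣) ·
  -- c(s, t) is the total over all deletions; the subtracted term stands on the right.
  c-deletion : ∀ {t} b → Topological t → 2 ≤ ∣ t ∣ →
    (∀ u → Topological u → suc ∣ u ∣ ≡ ∣ t ∣ → c s u ≤ b) →
    ∣ t ∣ * c s t ≤ ∣ t ∣ * b + ∣ s ∣ * c s t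
  c-deletion {t} b top 2≤t h = begin
    ∣ t ∣ * c s t
      ≡⟨ cong (∣ t ∣ *_) (c≡sumInduced s t) ⟩
    ∣ t ∣ * sumInduced t F
      ≡⟨ sumDeletions-sumInduced t F ⟨
    sumDeletions t (λ m → sumInduced? m F) + sumInduced t (λ m → size m * F m)
      ≤⟨ +-mono-≤ (sumDeletions-bound b top bound) (≤-reflexive (begin-equality
           sumInduced t (λ m → size m * F m)  ≡⟨ sumInduced-cong t (λ m → copy-size m (λ x → x)) ⟩
           sumInduced t (λ m → ∣ s ∣ * F m)   ≡⟨ sumInduced-* ∣ s ∣ t F ⟩
           ∣ s ∣ * sumInduced t F             ≡⟨ cong (∣ s ∣ *_) (c≡sumInduced s t) ⟨
           ∣ s ∣ * c s t                      ∎)) ⟩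
    ∣ t ∣ * b + ∣ s ∣ * c s t ∎
    where
    open ≤-Reasoning
    bound : ∀ m → MAll.All Topological m → suc (size m) ≡ ∣ t ∣ → sumInduced? m F ≤ b
    bound (just u) (just p) e = ≤-trans (≤-reflexive (sym (c≡sumInduced s u)))
      (h u p e)
    bound nothing  nothing  e = contradiction e (<⇒≢ 2≤t)

-- Blowing up the leaves

star : ℕ → Tree
star m = node (replicate m (node []))

leaves-replicate : ∀ m → leaves (replicate m (node [])) ≡ m
leaves-replicate zero    = refl
leaves-replicate (suc m) = cong suc (leaves-replicate m)

-- Only the singletons and the empty set are kept. The empty set has to stay: it is the choice in
-- the star of a leaf outside L.
sumInduced*-replicate : ∀ m G →
  m * G (node [] ∷ []) + G [] ≤ sumInduced* (replicate m (node [])) G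
sumInduced*-replicate zero    G = ≤-refl
sumInduced*-replicate (suc m) G = begin
  (g + m * g) + G []   ≡⟨ +-assoc g (m * g) (G []) ⟩
  -- Once the first leaf is chosen, only the empty choice among the other `m` leaves is retained.
  g + (m * g + G [])   ≤⟨ +-mono-≤ (m+n≤o⇒n≤o (m * _) (sumInduced*-replicate m (G ∘ (node [] ∷_))))
                                   (sumInduced*-replicate m G) ⟩
  sumInduced* (replicate (suc m) (node [])) G ∎
  where
  open ≤-Reasoning
  g = G (node [] ∷ [])

-- Multiplies the leaves by 2 + j, so that the result is again topological.
blowUp  : ℕ → Tree → Tree
blowUp* : ℕ → List Tree → List Tree

blowUp j (node [])         = star (2 + j)
blowUp j (node ts@(_ ∷ _)) = node (blowUp* j ts)

blowUp* j []       = []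
blowUp* j (t ∷ ts) = blowUp j t ∷ blowUp* j ts

length-blowUp* : ∀ j ts → length (blowUp* j ts) ≡ length ts
length-blowUp* j []       = refl
length-blowUp* j (_ ∷ ts) = cong suc (length-blowUp* j ts)

blowUp-topological : ∀ j {t} → Topological t → Topological (blowUp j t)
blowUp*-topological : ∀ j {ts} → All Topological ts → All Topological (blowUp* j ts)
blowUp-topological j leaf = node (s≤s (s≤s z≤n)) (All.replicate⁺ (2 + j) leaf)
blowUp-topological j (node {ts@(_ ∷ _)} p ps) =
  node (subst (2 ≤_) (sym (length-blowUp* j ts)) p) (blowUp*-topological j ps)
blowUp*-topological j []       = []
blowUp*-topological j (p ∷ ps) = blowUp-topological j p ∷ blowUp*-topological j ps

blowUp-size : ∀ j t → ∣ blowUp j t ∣ ≡ ∣ t ∣ * (2 + j)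
blowUp*-leaves : ∀ j ts → leaves (blowUp* j ts) ≡ leaves ts * (2 + j)
blowUp-size j (node [])         = trans (leaves-replicate (2 + j)) (sym (+-identityʳ (2 + j)))
blowUp-size j (node ts@(_ ∷ _)) = blowUp*-leaves j ts
blowUp*-leaves j []       = refl
blowUp*-leaves j (t ∷ ts) = trans
  (cong₂ _+_ (blowUp-size j t) (blowUp*-leaves j ts))
  (sym (*-distribʳ-+ (2 + j) ∣ t ∣ (leaves ts)))

-- Every induced tree with r leaves arises from at least (2 + j) ^ r sets of
-- leaves of the blow-up: choose one copy of each leaf.
sumInduced-blowUp : ∀ j t F →
  sumInduced t (λ m → (2 + j) ^ size m * F m) ≤ sumInduced (blowUp j t) F
sumInduced*-blowUp : ∀ j ts G →
  sumInduced* ts (λ us → (2 + j) ^ leaves us * G us) ≤ sumInduced* (blowUp* j ts) G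

sumInduced-blowUp j (node []) F = begin
  (2 + j) * 1 * F (just (node [])) + 1 * F nothing
    ≡⟨ cong₂ (λ x y → x * F (just (node [])) + y) (*-identityʳ (2 + j)) (+-identityʳ (F nothing)) ⟩
  (2 + j) * F (just (node [])) + F nothing
    ≤⟨ sumInduced*-replicate (2 + j) (F ∘ join) ⟩
  sumInduced (star (2 + j)) F ∎
  where open ≤-Reasoning
sumInduced-blowUp j (node ts@(_ ∷ _)) F = begin
  sumInduced* ts (λ us → (2 + j) ^ size (join us) * F (join us))
    ≡⟨ sumInduced*-cong ts (λ us → cong (λ n → (2 + j) ^ n * F (join us)) (size-join us)) ⟩
  sumInduced* ts (λ us → (2 + j) ^ leaves us * F (join us))
    ≤⟨ sumInduced*-blowUp j ts (F ∘ join) ⟩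
  sumInduced* (blowUp* j ts) (F ∘ join) ∎
  where open ≤-Reasoning

sumInduced*-blowUp j []       G = ≤-reflexive (+-identityʳ (G []))
sumInduced*-blowUp j (t ∷ ts) G = begin
  sumInduced t (λ x → sumInduced* ts λ us → (2 + j) ^ leaves (List.fromMaybe x ++ us) * g x us)
    ≡⟨ sumInduced-cong t split ⟩
  sumInduced t (λ x → (2 + j) ^ size x * sumInduced* ts λ us → (2 + j) ^ leaves us * g x us)
    ≤⟨ sumInduced-mono t (λ x → *-monoʳ-≤ ((2 + j) ^ size x) (sumInduced*-blowUp j ts (g x))) ⟩
  sumInduced t (λ x → (2 + j) ^ size x * sumInduced* (blowUp* j ts) (g x))
    ≤⟨ sumInduced-blowUp j t _ ⟩
  sumInduced* (blowUp* j (t ∷ ts)) G ∎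
  where
  open ≤-Reasoning
  g : Maybe Tree → List Tree → ℕ
  g x us = G (List.fromMaybe x ++ us)
  split : ∀ x → sumInduced* ts (λ us → (2 + j) ^ leaves (List.fromMaybe x ++ us) * g x us) ≡
                (2 + j) ^ size x * sumInduced* ts (λ us → (2 + j) ^ leaves us * g x us)
  split x = trans
    (sumInduced*-cong ts λ us → trans
      (cong (_* g x us) (trans (cong ((2 + j) ^_) (leaves-fromMaybe x us))
                               (^-distribˡ-+-* (2 + j) (size x) (leaves us))))
      (*-assoc ((2 + j) ^ size x) _ _))
    (sumInduced*-* ((2 + j) ^ size x) ts _)

c-blowUp : ∀ j s t → (2 + j) ^ ∣ s ∣ * c s t ≤ c s (blowUp j t)
c-blowUp j s t = begin
  (2 + j) ^ ∣ s ∣ * c s t             ≡⟨ cong ((2 + j) ^ ∣ s ∣ *_) (c≡sumInduced s t) ⟩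
  (2 + j) ^ ∣ s ∣ * sumInduced t F    ≡⟨ sumInduced-* ((2 + j) ^ ∣ s ∣) t F ⟨
  sumInduced t (λ m → (2 + j) ^ ∣ s ∣ * F m)
    ≡⟨ sumInduced-cong t (λ m → copy-size s m ((2 + j) ^_)) ⟨
  sumInduced t (λ m → (2 + j) ^ size m * F m)
    ≤⟨ sumInduced-blowUp j t F ⟩
  sumInduced (blowUp j t) F           ≡⟨ c≡sumInduced s (blowUp j t) ⟨
  c s (blowUp j t)                    ∎
  where
  open ≤-Reasoning
  F : Maybe Tree → ℕ
  F m = 𝟙 (copies? s m)

-- Counting leaf sets by size

-- Σ f(∣L∣) over the subsets L of an n-element set.
sumSizes : ℕ → (ℕ → ℕ) → ℕ
sumSizes zero    f = f 0
sumSizes (suc n) f = sumSizes n (f ∘ suc) + sumSizes n f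

sumSizes-cong : ∀ n {f g} → (∀ i → f i ≡ g i) → sumSizes n f ≡ sumSizes n g
sumSizes-cong zero    e = e 0
sumSizes-cong (suc n) e = cong₂ _+_ (sumSizes-cong n (e ∘ suc)) (sumSizes-cong n e)

sumSizes-+ : ∀ m n f → sumSizes m (λ i → sumSizes n λ j → f (i + j)) ≡ sumSizes (m + n) f
sumSizes-+ zero    n f = refl
sumSizes-+ (suc m) n f = cong₂ _+_ (sumSizes-+ m n (f ∘ suc)) (sumSizes-+ m n f)

sumInduced-size : ∀ t f → sumInduced t (f ∘ size) ≡ sumSizes (∣ t ∣) f
sumInduced*-leaves : ∀ ts f → sumInduced* ts (f ∘ leaves) ≡ sumSizes (leaves ts) f
sumInduced-size (node [])         f = refl
sumInduced-size (node ts@(_ ∷ _)) f = trans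
  (sumInduced*-cong ts λ us → cong f (size-join us)) (sumInduced*-leaves ts f)
sumInduced*-leaves []       f = refl
sumInduced*-leaves (t ∷ ts) f = begin
  sumInduced t (λ x → sumInduced* ts λ us → f (leaves (List.fromMaybe x ++ us)))
    ≡⟨ sumInduced-cong t (λ x → trans
         (sumInduced*-cong ts λ us → cong f (leaves-fromMaybe x us))
         (sumInduced*-leaves ts (λ j → f (size x + j)))) ⟩
  sumInduced t (λ x → sumSizes (leaves ts) λ j → f (size x + j))
    ≡⟨ sumInduced-size t (λ i → sumSizes (leaves ts) λ j → f (i + j)) ⟩
  sumSizes (∣ t ∣) (λ i → sumSizes (leaves ts) λ j → f (i + j))
    ≡⟨ sumSizes-+ ∣ t ∣ (leaves ts) f ⟩
  sumSizes (∣ t ∣ + leaves ts) f ∎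
  where open ≡-Reasoning

sumSizes-const0 : ∀ n → sumSizes n (const 0) ≡ 0
sumSizes-const0 zero    = refl
sumSizes-const0 (suc n) = cong₂ _+_ (sumSizes-const0 n) (sumSizes-const0 n)

δ : ℕ → ℕ → ℕ
δ k i = if i ≡ᵇ k then 1 else 0

sumSizes-≡ : ∀ n k → sumSizes n (δ k) ≡ n C k
sumSizes-≡ zero    zero    = refl
sumSizes-≡ zero    (suc k) = refl
sumSizes-≡ (suc n) zero    = cong₂ _+_ (sumSizes-const0 n) (sumSizes-≡ n 0)
sumSizes-≡ (suc n) (suc k) = trans
  (cong₂ _+_ (sumSizes-≡ n k) (sumSizes-≡ n (suc k))) (nCk+nC[k+1]≡[n+1]C[k+1] n k)

-- The indicator of a copy is dominated by the indicator of having ∣ s ∣ leaves. So densities are at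
-- most 1, which turns the relative loss of the blow-up into an absolute one.
c≤C : ∀ s t → c s t ≤ ∣ t ∣ C ∣ s ∣
c≤C s t = begin
  c s t                                    ≡⟨ c≡sumInduced s t ⟩
  sumInduced t (λ m → 𝟙 (copies? s m))     ≤⟨ sumInduced-mono t bound ⟩
  sumInduced t (δ ∣ s ∣ ∘ size)         ≡⟨ sumInduced-size t (δ ∣ s ∣) ⟩
  sumSizes (∣ t ∣) (δ ∣ s ∣)              ≡⟨ sumSizes-≡ ∣ t ∣ ∣ s ∣ ⟩
  ∣ t ∣ C ∣ s ∣                            ∎
  where
  open ≤-Reasoning
  1≤ : ∀ n → 1 ≤ δ n n
  1≤ zero    = ≤-refl
  1≤ (suc n) = 1≤ n
  bound : ∀ m → 𝟙 (copies? s m) ≤ δ ∣ s ∣ (size m)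
  bound m with copies? s m
  ... | yes (just p) rewrite ≅-size p = 1≤ ∣ s ∣
  ... | no _ = z≤n

-- Binomial coefficients

-- (k + 1) C(n, k + 1) = (n - k) C(n, k) without subtraction, hence valid also for k > n; proved by
-- Pascal's rule.
[k+1]C[k+1]+kCk : ∀ n k → suc k * (n C suc k) + k * (n C k) ≡ n * (n C k)
[k+1]C[k+1]+kCk zero    zero    = refl
[k+1]C[k+1]+kCk zero    (suc k) =
  cong₂ _+_ (*-zeroʳ (suc (suc k))) (*-zeroʳ (suc k))
[k+1]C[k+1]+kCk (suc n) zero    = trans (+-identityʳ _)
  (trans (*-identityˡ _) (trans (nC1≡n (suc n)) (sym (*-identityʳ (suc n)))))
[k+1]C[k+1]+kCk (suc n) (suc k) = begin
  (2 + k) * (suc n C (2 + k)) + suc k * (suc n C suc k)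
    ≡⟨ cong₂ (λ x y → (2 + k) * x + suc k * y) 
         (nCk+nC[k+1]≡[n+1]C[k+1] n (suc k)) (nCk+nC[k+1]≡[n+1]C[k+1] n k) ⟨
  (2 + k) * (y + z) + suc k * (x + y)
    ≡⟨ solve 4 (λ k x y z → (con 2 :+ k) :* (y :+ z) :+ (con 1 :+ k) :* (x :+ y) :=
         ((con 2 :+ k) :* z :+ (con 1 :+ k) :* y) :+ ((con 1 :+ k) :* y :+ k :* x) :+ (x :+ y)) refl k x y z ⟩
  ((2 + k) * z + suc k * y) + (suc k * y + k * x) + (x + y)
    ≡⟨ cong₂ (λ u v → u + v + (x + y)) ([k+1]C[k+1]+kCk n (suc k)) ([k+1]C[k+1]+kCk n k) ⟩
  n * y + n * x + (x + y)
    ≡⟨ solve 3 (λ n x y → n :* y :+ n :* x :+ (x :+ y) := (con 1 :+ n) :* (x :+ y)) refl n x y ⟩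
  suc n * (x + y)
    ≡⟨ cong (suc n *_) (nCk+nC[k+1]≡[n+1]C[k+1] n k) ⟩
  suc n * (suc n C suc k) ∎
  where
  open ≡-Reasoning
  x = n C k
  y = n C suc k
  z = n C (2 + k)

-- (n + 1) C(n, k) = (n + 1 - k) C(n + 1, k), the counterpart of `c-deletion` for the denominators.
[n+1]Ck-rec : ∀ n k → suc n * (n C k) + k * (suc n C k) ≡ suc n * (suc n C k)
[n+1]Ck-rec n zero    = +-identityʳ _
[n+1]Ck-rec n (suc k) = begin
  suc n * y + suc k * (suc n C suc k)
    ≡⟨ cong (λ w → suc n * y + suc k * w) (nCk+nC[k+1]≡[n+1]C[k+1] n k) ⟨
  suc n * y + suc k * (x + y)
    ≡⟨ solve 4 (λ n k x y → (con 1 :+ n) :* y :+ (con 1 :+ k) :* (x :+ y) :=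
         (con 1 :+ n) :* y :+ x :+ ((con 1 :+ k) :* y :+ k :* x)) refl n k x y ⟩
  suc n * y + x + (suc k * y + k * x)
    ≡⟨ cong (suc n * y + x +_) ([k+1]C[k+1]+kCk n k) ⟩
  suc n * y + x + n * x
    ≡⟨ solve 3 (λ n x y → (con 1 :+ n) :* y :+ x :+ n :* x := (con 1 :+ n) :* (x :+ y)) refl n x y ⟩
  suc n * (x + y)
    ≡⟨ cong (suc n *_) (nCk+nC[k+1]≡[n+1]C[k+1] n k) ⟩
  suc n * (suc n C suc k) ∎
  where
  open ≡-Reasoning
  x = n C k
  y = n C suc k

-- The falling factorial n (n - 1) ⋯ (n - k + 1).
k!*nCk : ℕ → ℕ → ℕ
k!*nCk n k = k ! * (n C k)

k!*nCk-rec : ∀ n k → k!*nCk n (suc k) + k * k!*nCk n k ≡ n * k!*nCk n k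
k!*nCk-rec n k = begin
  suc k * k ! * (n C suc k) + k * (k ! * (n C k))
    ≡⟨ solve 4 (λ k f x y → (con 1 :+ k) :* f :* y :+ k :* (f :* x) :=
         f :* ((con 1 :+ k) :* y :+ k :* x)) refl k (k !) (n C k) (n C suc k) ⟩
  k ! * (suc k * (n C suc k) + k * (n C k))
    ≡⟨ cong (k ! *_) ([k+1]C[k+1]+kCk n k) ⟩
  k ! * (n * (n C k))
    ≡⟨ solve 3 (λ f n x → f :* (n :* x) := n :* (f :* x)) refl (k !) n (n C k) ⟩
  n * k!*nCk n k ∎
  where open ≡-Reasoning

k!*nCk≤n^k : ∀ n k → k!*nCk n k ≤ n ^ k
k!*nCk≤n^k n zero    = ≤-refl
k!*nCk≤n^k n (suc k) = begin
  k!*nCk n (suc k)                     ≤⟨ m≤m+n _ _ ⟩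
  k!*nCk n (suc k) + k * k!*nCk n k    ≡⟨ k!*nCk-rec n k ⟩
  n * k!*nCk n k                       ≤⟨ *-monoʳ-≤ n (k!*nCk≤n^k n k) ⟩
  n * n ^ k                            ∎
  where open ≤-Reasoning

-- Bernoulli: n (n ∸ 1) ⋯ (n ∸ k + 1) ≥ (1 - k (k - 1) / n) n ^ k.
n^[1+k]≤ : ∀ n k → n * n ^ k ≤ n * k!*nCk n k + k * (k ∸ 1) * n ^ k
n^[1+k]≤ n zero    = m≤m+n _ _
n^[1+k]≤ n (suc k) = begin
  n * (n * n ^ k)
    ≤⟨ *-monoʳ-≤ n (n^[1+k]≤ n k) ⟩
  n * (n * p + k * (k ∸ 1) * q)
    ≡⟨ cong (λ w → n * (w + k * (k ∸ 1) * q)) (k!*nCk-rec n k) ⟨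
  n * (p′ + k * p + k * (k ∸ 1) * q)
    -- Rounding k ∸ 1 up to k removes the truncated subtraction and gives exactly k + k · k = (k +
    -- 1) k.
    ≤⟨ *-monoʳ-≤ n (+-mono-≤ (+-monoʳ-≤ p′ (*-monoʳ-≤ k (k!*nCk≤n^k n k)))
                              (*-monoˡ-≤ q (*-monoʳ-≤ k (m∸n≤m k 1)))) ⟩
  n * (p′ + k * q + k * k * q)
    ≡⟨ solve 4 (λ n k p q → n :* (p :+ k :* q :+ k :* k :* q) :=
         n :* p :+ (con 1 :+ k) :* k :* (n :* q)) refl n k p′ q ⟩
  n * p′ + suc k * k * (n * q) ∎
  where
  open ≤-Reasoning
  p = k!*nCk n k
  p′ = k!*nCk n (suc k)
  q = n ^ k

^-distribʳ-* : ∀ m n k → (m * n) ^ k ≡ m ^ k * n ^ k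
^-distribʳ-* m n zero    = refl
^-distribʳ-* m n (suc k) = trans (cong (m * n *_) (^-distribʳ-* m n k))
  (solve 4 (λ m n x y → m :* n :* (x :* y) := m :* x :* (n :* y)) refl m n (m ^ k) (n ^ k))

-- With denominators cleared: m ^ k · C(n, k) / C(nm, k) ≥ 1 - k (k - 1) / n. After multiplication
-- by k !, the binomial C(nm, k) is at most (nm) ^ k and C(n, k) is bounded below by `n^[1+k]≤`. If
-- n ≤ k (k - 1), the right side is not positive.
nC-blowUp : ∀ n m k → n * ((n * m) C k) ≤ k * (k ∸ 1) * ((n * m) C k) + n * (m ^ k * (n C k))
nC-blowUp n m k with ≤-total n (k * (k ∸ 1))
... | inj₁ n≤K = ≤-trans (*-monoˡ-≤ _ n≤K) (m≤m+n _ _)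
... | inj₂ K≤n = begin
  n * Q              ≡⟨ cong (_* Q) (m+[n∸m]≡n K≤n) ⟨
  (K + d) * Q        ≡⟨ *-distribʳ-+ Q K d ⟩
  K * Q + d * Q      ≤⟨ +-monoʳ-≤ (K * Q) (*-cancelˡ-≤ (k !) {{k !≢0}} scaled) ⟩
  K * Q + n * (m ^ k * (n C k)) ∎
  where
  open ≤-Reasoning
  K = k * (k ∸ 1)
  d = n ∸ K
  Q = (n * m) C k
  bound : d * n ^ k ≤ n * k!*nCk n k
  bound = +-cancelʳ-≤ (K * n ^ k) _ _ (begin
    d * n ^ k + K * n ^ k           ≡⟨ *-distribʳ-+ (n ^ k) d K ⟨
    (d + K) * n ^ k                 ≡⟨ cong (_* n ^ k) (m∸n+n≡m K≤n) ⟩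
    n * n ^ k                       ≤⟨ n^[1+k]≤ n k ⟩
    n * k!*nCk n k + K * n ^ k      ∎)
  scaled : k ! * (d * Q) ≤ k ! * (n * (m ^ k * (n C k)))
  scaled = begin
    k ! * (d * Q)
      ≡⟨ solve 3 (λ f d q → f :* (d :* q) := d :* (f :* q)) refl (k !) d Q ⟩
    d * k!*nCk (n * m) k
      ≤⟨ *-monoʳ-≤ d (k!*nCk≤n^k (n * m) k) ⟩
    d * (n * m) ^ k
      ≡⟨ cong (d *_) (^-distribʳ-* n m k) ⟩
    d * (n ^ k * m ^ k)
      ≡⟨ *-assoc d _ _ ⟨
    d * n ^ k * m ^ k
      ≤⟨ *-monoˡ-≤ (m ^ k) bound ⟩
    n * (k ! * (n C k)) * m ^ k
      ≡⟨ solve 4 (λ n f p q → n :* (f :* p) :* q := f :* (n :* (q :* p))) refl n (k !) (n C k) (m ^ k) ⟩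
    k ! * (n * (m ^ k * (n C k))) ∎

-- Quotients and real sequences

÷-mono-≤ : ∀ a b c d .{{_ : NonZero b}} .{{_ : NonZero d}} → a * d ≤ c * b → a ÷ b ℚ.≤ c ÷ d
÷-mono-≤ a (suc b) c (suc d) le = ℚ.toℚᵘ-cancel-≤ (begin
  ℚ.toℚᵘ (a ÷ suc b)  ≃⟨ ℚ.toℚᵘ-fromℚᵘ (mkℚᵘ (ℤ.+ a) b) ⟩
  mkℚᵘ (ℤ.+ a) b      ≤⟨ ℚᵘ.*≤* (subst₂ ℤ._≤_ (ℤ.pos-* a (suc d)) (ℤ.pos-* c (suc b)) (ℤ.+≤+ le)) ⟩
  mkℚᵘ (ℤ.+ c) d      ≃⟨ ℚ.toℚᵘ-fromℚᵘ (mkℚᵘ (ℤ.+ c) d) ⟨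
  ℚ.toℚᵘ (c ÷ suc d)  ∎)
  where open ℚᵘ.≤-Reasoning

÷-cancel-≤ : ∀ a b c d .{{_ : NonZero b}} .{{_ : NonZero d}} → a ÷ b ℚ.≤ c ÷ d → a * d ≤ c * b
÷-cancel-≤ a (suc b) c (suc d) le = ℤ.drop‿+≤+ (subst₂ ℤ._≤_
  (sym (ℤ.pos-* a (suc d))) (sym (ℤ.pos-* c (suc b)))
  (ℚᵘ.drop-*≤* (begin
    mkℚᵘ (ℤ.+ a) b      ≃⟨ ℚ.toℚᵘ-fromℚᵘ (mkℚᵘ (ℤ.+ a) b) ⟨
    ℚ.toℚᵘ (a ÷ suc b)  ≤⟨ ℚ.toℚᵘ-mono-≤ le ⟩
    ℚ.toℚᵘ (c ÷ suc d)  ≃⟨ ℚ.toℚᵘ-fromℚᵘ (mkℚᵘ (ℤ.+ c) d) ⟩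
    mkℚᵘ (ℤ.+ c) d      ∎)))
  where open ℚᵘ.≤-Reasoning

÷-+ : ∀ a b c d .{{_ : NonZero b}} .{{_ : NonZero d}} → a ÷ b ℚ.+ c ÷ d ≡ (a * d + c * b) ÷ (b * d)
÷-+ a (suc b) c (suc d) = ℚ.toℚᵘ-injective (begin-equality
  ℚ.toℚᵘ (a ÷ suc b ℚ.+ c ÷ suc d)
    ≃⟨ ℚ.toℚᵘ-homo-+ (a ÷ suc b) (c ÷ suc d) ⟩
  ℚ.toℚᵘ (a ÷ suc b) ℚᵘ.+ ℚ.toℚᵘ (c ÷ suc d)
    ≃⟨ ℚᵘ.+-cong (ℚ.toℚᵘ-fromℚᵘ (mkℚᵘ (ℤ.+ a) b)) (ℚ.toℚᵘ-fromℚᵘ (mkℚᵘ (ℤ.+ c) d)) ⟩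
  mkℚᵘ (ℤ.+ a) b ℚᵘ.+ mkℚᵘ (ℤ.+ c) d
    ≡⟨ cong (λ x → mkℚᵘ x (d + b * suc d)) (trans
         (cong₂ ℤ._+_ (sym (ℤ.pos-* a (suc d))) (sym (ℤ.pos-* c (suc b))))
         (sym (ℤ.pos-+ (a * suc d) (c * suc b)))) ⟩
  mkℚᵘ (ℤ.+ (a * suc d + c * suc b)) (d + b * suc d)
    ≃⟨ ℚ.toℚᵘ-fromℚᵘ (mkℚᵘ (ℤ.+ (a * suc d + c * suc b)) (d + b * suc d)) ⟨
  ℚ.toℚᵘ ((a * suc d + c * suc b) ÷ (suc b * suc d)) ∎)
  where open ℚᵘ.≤-Reasoning

0≤÷ : ∀ m n → 0ℚ ℚ.≤ m ÷ n
0≤÷ m zero    = ℚ.≤-refl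
0≤÷ m (suc n) = ℚ.nonNegative⁻¹ (m ÷ suc n) {{ℚ.normalize-nonNeg m (suc n)}}

÷-small : ∀ m ε → 0ℚ ℚ.< ε → ∃ λ N → ∀ n → N ≤ n → m ÷ n ℚ.≤ ε
÷-small m (mkℚ ℤ.+0       d _) (ℚ.*<* (ℤ.+<+ ()))
÷-small m (mkℚ ℤ.-[1+ p ] d _) (ℚ.*<* ())
-- Here ε ≥ 1 / `suc d`, and m / n is at most that once n ≥ `m * suc d`. For n = 0 the convention
-- `m ÷ 0 = 0` applies.
÷-small m ε@(mkℚ ℤ.+[1+ p ] d _) 0<ε = m * suc d , λ where
  zero    _  → ℚ.<⇒≤ 0<ε
  (suc n) N≤ → subst (m ÷ suc n ℚ.≤_) (ℚ.fromℚᵘ-toℚᵘ ε)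
    (÷-mono-≤ m (suc n) (suc p) (suc d) (≤-trans N≤ (m≤m+n (suc n) (p * suc n))))

p≤q+r⇒p-q≤r : ∀ {p q r} → p ℚ.≤ q ℚ.+ r → p ℚ.- q ℚ.≤ r
p≤q+r⇒p-q≤r {p} {q} {r} le = begin
  p ℚ.- q          ≤⟨ ℚ.+-monoˡ-≤ (ℚ.- q) le ⟩
  q ℚ.+ r ℚ.- q    ≡⟨ ℚ-solve 2 (λ q r → q ⊞ r ⊟ q ⩵ r) refl q r ⟩
  r                ∎
  where open ℚ.≤-Reasoning

p-q≤r⇒p≤q+r : ∀ {p q r} → p ℚ.- q ℚ.≤ r → p ℚ.≤ q ℚ.+ r
p-q≤r⇒p≤q+r {p} {q} {r} le = begin
  p                  ≡⟨ ℚ-solve 2 (λ p q → p ⩵ q ⊞ (p ⊟ q)) refl p q ⟩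
  q ℚ.+ (p ℚ.- q)    ≤⟨ ℚ.+-monoʳ-≤ q le ⟩
  q ℚ.+ r            ∎
  where open ℚ.≤-Reasoning

∣p-q∣≤ : ∀ {p q r} → p ℚ.≤ q ℚ.+ r → q ℚ.≤ p ℚ.+ r → ℚ.∣ p ℚ.- q ∣ ℚ.≤ r
∣p-q∣≤ {p} {q} p≤ q≤ with ℚ.∣p∣≡p∨∣p∣≡-p (p ℚ.- q)
... | inj₁ eq = ℚ.≤-trans (ℚ.≤-reflexive eq) (p≤q+r⇒p-q≤r p≤)
... | inj₂ eq = ℚ.≤-trans
  (ℚ.≤-reflexive (trans eq (ℚ-solve 2 (λ p q → ⊟ (p ⊟ q) ⩵ q ⊟ p) refl p q)))
  (p≤q+r⇒p-q≤r q≤)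

p≤q⇒p≤q+ε : ∀ {p q ε} → 0ℚ ℚ.< ε → p ℚ.≤ q → p ℚ.≤ q ℚ.+ ε
p≤q⇒p≤q+ε {p} 0<ε p≤q =
  ℚ.≤-trans (ℚ.≤-reflexive (sym (ℚ.+-identityʳ p))) (ℚ.+-mono-≤ p≤q (ℚ.<⇒≤ 0<ε))

½*-pos : ∀ {ε} → 0ℚ ℚ.< ε → 0ℚ ℚ.< ½ ℚ.* ε
½*-pos {ε} 0<ε = subst (ℚ._< ½ ℚ.* ε) (ℚ.*-zeroʳ ½) (ℚ.*-monoʳ-<-pos ½ 0<ε)

½+½ : ∀ p ε → p ℚ.+ ½ ℚ.* ε ℚ.+ ½ ℚ.* ε ≡ p ℚ.+ ε
½+½ p ε = trans (ℚ.+-assoc p _ _) (cong (p ℚ.+_)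
  (trans (sym (ℚ.*-distribʳ-+ ε ½ ½)) (ℚ.*-identityˡ ε)))

-- The order on the reals and limits of eventually decreasing sequences

≤ᵣ-trans : ∀ {x y z} → x ≤ᵣ y → y ≤ᵣ z → x ≤ᵣ z
≤ᵣ-trans {x} {y} {z} x≤y y≤z ε 0<ε =
  let M , p = x≤y (½ ℚ.* ε) (½*-pos 0<ε)
      N , q = y≤z (½ ℚ.* ε) (½*-pos 0<ε)
      open ℚ.≤-Reasoning
  in M ⊔ N , λ n n≥ → begin
    seq x n
      ≤⟨ p n (m⊔n≤o⇒m≤o M N n≥) ⟩
    seq y n ℚ.+ ½ ℚ.* ε
      ≤⟨ ℚ.+-monoˡ-≤ (½ ℚ.* ε) (q n (m⊔n≤o⇒n≤o M N n≥)) ⟩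
    seq z n ℚ.+ ½ ℚ.* ε ℚ.+ ½ ℚ.* ε
      ≡⟨ ½+½ (seq z n) ε ⟩
    seq z n ℚ.+ ε ∎

fromℚ-mono : ∀ {p q} → p ℚ.≤ q → fromℚ p ≤ᵣ fromℚ q
fromℚ-mono p≤q ε 0<ε = 0 , λ _ _ → p≤q⇒p≤q+ε 0<ε p≤q

-- The sequence need only decrease from `k` on; through `n ⊔ k`, `antitone` also says that no term
-- before `k` exceeds `a k`.
module Decreasing (a e : ℕ → ℚ) (k : ℕ)
  (antitone : ∀ {n j} → n ≤ j → a j ℚ.≤ a (n ⊔ k))
  (rate : ∀ {n j} → k ≤ n → n ≤ j → a n ℚ.≤ a j ℚ.+ e n)
  (e-small : ∀ ε → 0ℚ ℚ.< ε → ∃ λ N → ∀ n → N ≤ n → e n ℚ.≤ ε) where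

  antitone-≥k : ∀ {n j} → k ≤ n → n ≤ j → a j ℚ.≤ a n
  antitone-≥k {n} {j} k≤n n≤j = subst (λ m → a j ℚ.≤ a m) (m≥n⇒m⊔n≡m k≤n) (antitone n≤j)

  a-cauchy : IsCauchy a
  a-cauchy ε 0<ε = N ⊔ k , ordered
    where
    N     = proj₁ (e-small ε 0<ε)
    small = proj₂ (e-small ε 0<ε)
    below : ∀ {m n} → N ⊔ k ≤ m → m ≤ n → a m ℚ.≤ a n ℚ.+ ε
    below {m} {n} m≥ m≤n = ℚ.≤-trans (rate (m⊔n≤o⇒n≤o N k m≥) m≤n)
      (ℚ.+-monoʳ-≤ (a n) (small m (m⊔n≤o⇒m≤o N k m≥)))
    above : ∀ {m n} → N ⊔ k ≤ m → m ≤ n → a n ℚ.≤ a m ℚ.+ ε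
    above m≥ m≤n = p≤q⇒p≤q+ε 0<ε (antitone-≥k (m⊔n≤o⇒n≤o N k m≥) m≤n)
    ordered : ∀ m n → N ⊔ k ≤ m → N ⊔ k ≤ n → ℚ.∣ a m ℚ.- a n ∣ ℚ.≤ ε
    ordered m n m≥ n≥ with ≤-total m n
    ... | inj₁ m≤n = ∣p-q∣≤ (below m≥ m≤n) (above m≥ m≤n)
    ... | inj₂ n≤m = ∣p-q∣≤ (above n≥ n≤m) (below n≥ n≤m)

  -- The Cauchy sequence `a` represents its own limit.
  limit : ℝ
  limit = mkℝ a a-cauchy

  aᵣ : ℕ → ℝ
  aᵣ n = fromℚ (a n)

  limit-isLimsup : IsLimsup aᵣ limit
  -- The tail from `n` attains its supremum at the index `n ⊔ k`.
  limit-isLimsup = (λ n → aᵣ (n ⊔ k)) , sup , lower , greatest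
    where
    sup : ∀ n → IsSup (λ i → aᵣ (n + i)) (aᵣ (n ⊔ k))
    sup n = (λ i → fromℚ-mono (antitone (m≤m+n n i))) ,
            (λ u h → subst (λ m → aᵣ m ≤ᵣ u) (m+[n∸m]≡n (m≤m⊔n n k)) (h (n ⊔ k ∸ n)))
    lower : ∀ n → limit ≤ᵣ aᵣ (n ⊔ k)
    lower n ε 0<ε = n , λ i n≤i → p≤q⇒p≤q+ε 0<ε (antitone n≤i)
    greatest : ∀ l → (∀ n → l ≤ᵣ aᵣ (n ⊔ k)) → l ≤ᵣ limit
    greatest l h ε 0<ε =
      let N , small = e-small (½ ℚ.* ε) (½*-pos 0<ε)
          n         = N ⊔ k
          M , p     = h n (½ ℚ.* ε) (½*-pos 0<ε)
          open ℚ.≤-Reasoning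
      in n ⊔ M , λ i i≥ → begin
        seq l i
          ≤⟨ p i (m⊔n≤o⇒n≤o n M i≥) ⟩
        a (n ⊔ k) ℚ.+ ½ ℚ.* ε
          ≡⟨ cong (λ m → a m ℚ.+ ½ ℚ.* ε) (m≥n⇒m⊔n≡m (m≤n⊔m N k)) ⟩
        a n ℚ.+ ½ ℚ.* ε
          ≤⟨ ℚ.+-monoˡ-≤ (½ ℚ.* ε) (rate (m≤n⊔m N k) (m⊔n≤o⇒m≤o n M i≥)) ⟩
        a i ℚ.+ e n ℚ.+ ½ ℚ.* ε
          ≤⟨ ℚ.+-monoˡ-≤ (½ ℚ.* ε) (ℚ.+-monoʳ-≤ (a i) (small n (m≤m⊔n N k))) ⟩
        a i ℚ.+ ½ ℚ.* ε ℚ.+ ½ ℚ.* ε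
          ≡⟨ ½+½ (a i) ε ⟩
        a i ℚ.+ ε ∎

  module _ {J : ℝ} (J-limsup : IsLimsup aᵣ J) {n : ℕ} (k≤n : k ≤ n) where

    private
      s        = proj₁ J-limsup
      sup      = proj₁ (proj₂ J-limsup)
      lower    = proj₁ (proj₂ (proj₂ J-limsup))
      greatest = proj₂ (proj₂ (proj₂ J-limsup))

    J≤a : J ≤ᵣ aᵣ n
    J≤a = ≤ᵣ-trans {J} {s n} {aᵣ n} (lower n)
      (proj₂ (sup n) (aᵣ n) λ i → fromℚ-mono (antitone-≥k k≤n (m≤m+n n i)))

    -- It suffices to stay below every tail supremum `s j`. The index `j + n` lies in the tail from
    -- `j` and is also at least `n`, so `rate` applies to its term.
    a-e≤J : fromℚ (a n ℚ.- e n) ≤ᵣ J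
    a-e≤J = greatest (fromℚ (a n ℚ.- e n)) λ j → ≤ᵣ-trans {fromℚ (a n ℚ.- e n)} {aᵣ (j + n)} {s j}
      (fromℚ-mono (p≤q+r⇒p-q≤r
        (subst (a n ℚ.≤_) (ℚ.+-comm (a (j + n)) (e n)) (rate k≤n (m≤n+m n j)))))
      (proj₁ (sup j) n)

    0≤a-J : fromℚ 0ℚ ≤ᵣ aᵣ n -ᵣ J
    0≤a-J ε 0<ε = let N , p = J≤a ε 0<ε in N , λ i i≥ →
      subst (0ℚ ℚ.≤_) (ℚ-solve 3 (λ a j ε → (a ⊞ ε) ⊟ j ⩵ (a ⊟ j) ⊞ ε) refl (a n) (seq J i) ε)
        (subst (ℚ._≤ (a n ℚ.+ ε) ℚ.- seq J i) (ℚ.+-inverseʳ (seq J i))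
          (ℚ.+-monoˡ-≤ (ℚ.- seq J i) (p i i≥)))

    a-J≤e : aᵣ n -ᵣ J ≤ᵣ fromℚ (e n)
    a-J≤e ε 0<ε = let N , p = a-e≤J ε 0<ε in N , λ i i≥ →
      p≤q+r⇒p-q≤r (subst (a n ℚ.≤_)
        (ℚ-solve 3 (λ e j ε → e ⊞ (j ⊞ ε) ⩵ j ⊞ (e ⊞ ε)) refl (e n) (seq J i) ε)
        (p-q≤r⇒p≤q+r (p i i≥)))

  limsup-isLimit : ∀ {J} → IsLimsup aᵣ J → IsLimit aᵣ J
  limsup-isLimit {J} J-limsup ε 0<ε =
    let N , small = e-small ε 0<ε in
    N ⊔ k , λ n n≥ δ 0<δ →
    let k≤n   = m⊔n≤o⇒n≤o N k n≥
        M₁ , p = J≤a {J} J-limsup k≤n δ 0<δ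
        M₂ , q = a-J≤e {J} J-limsup k≤n δ 0<δ
    in M₁ ⊔ M₂ , λ i i≥ → ∣p-q∣≤
      (p-q≤r⇒p≤q+r {a n} {seq J i} (ℚ.≤-trans (q i (m⊔n≤o⇒n≤o M₁ M₂ i≥))
        (ℚ.+-monoˡ-≤ δ (small n (m⊔n≤o⇒m≤o N k n≥)))))
      (ℚ.≤-trans (p i (m⊔n≤o⇒m≤o M₁ M₂ i≥))
        (ℚ.+-monoʳ-≤ (a n)
          (subst (ℚ._≤ ε ℚ.+ δ) (ℚ.+-identityˡ δ) (ℚ.+-monoˡ-≤ δ (ℚ.<⇒≤ 0<ε)))))

1≤∣t∣ : ∀ t → 1 ≤ ∣ t ∣
1≤∣t∣ (node [])       = ≤-refl
1≤∣t∣ (node (t ∷ ts)) = ≤-trans (1≤∣t∣ t) (m≤m+n ∣ t ∣ (leaves ts))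

nCk≢0 : ∀ {n k} → k ≤ n → NonZero (n C k)
nCk≢0 {n}     z≤n       = _
nCk≢0 {suc n} {suc k} (s≤s k≤n) rewrite sym (nCk+nC[k+1]≡[n+1]C[k+1] n k) =
  >-nonZero (≤-trans (>-nonZero⁻¹ _ {{nCk≢0 k≤n}}) (m≤m+n _ _))

-- The maximal density

module MaxDensity (S : Tree) where

  private
    k = ∣ S ∣

    1≤ : ∀ {n} → k ≤ n → 1 ≤ n
    1≤ = ≤-trans (1≤∣t∣ S)

  maximiser : ∀ {n} → 1 ≤ n →
    ∃ λ t → Topological t × (∣ t ∣ ≡ n) × (c S t ÷ (n C k) ≡ maxγ S n)
  maximiser {n} 1≤n =
    let t , top , eq , γ≡ = maxγ-attained S n 1≤n
    in t , top , eq , trans (cong (λ m → c S t ÷ (m C k)) (sym eq)) γ≡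

  maxγ≥ : ∀ {t n} → Topological t → ∣ t ∣ ≡ n → c S t ÷ (n C k) ℚ.≤ maxγ S n
  maxγ≥ top refl = γ≤maxγ S top refl

  maxγ-suc : ∀ {n} → k ≤ n → maxγ S (suc n) ℚ.≤ maxγ S n
  maxγ-suc {n} k≤n =
    let t , t-top , ∣t∣≡ , t-max = maximiser {suc n} (s≤s z≤n)
        u , _     , _    , u-max = maximiser (1≤ k≤n)
        x = c S t
        y = c S u
        u-maximal : ∀ v → Topological v → suc ∣ v ∣ ≡ ∣ t ∣ → c S v ≤ y
        u-maximal v v-top eq = *-cancelʳ-≤ (c S v) y P (÷-cancel-≤ (c S v) P y P
          (ℚ.≤-trans (maxγ≥ v-top (suc-injective (trans eq ∣t∣≡))) (ℚ.≤-reflexive (sym u-max))))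
        deletion : suc n * x ≤ suc n * y + k * x
        deletion = subst (λ m → m * x ≤ m * y + k * x) ∣t∣≡
          (c-deletion S y t-top (subst (2 ≤_) (sym ∣t∣≡) (s≤s (1≤ k≤n))) u-maximal)
        open ≤-Reasoning
        -- With r = n + 1 - k: (n + 1) x P = r x P′ ≤ (n + 1) y P′, by `[n+1]Ck-rec` and `deletion`.
        -- Adding `k * x * P′` to both sides replaces the subtraction in r.
        cross : x * P ≤ y * P′
        cross = *-cancelˡ-≤ (suc n) (+-cancelʳ-≤ (k * x * P′) _ _ (begin
          suc n * (x * P) + k * x * P′
            ≡⟨ solve 5 (λ n k x p p′ → n :* (x :* p) :+ k :* x :* p′ := x :* (n :* p :+ k :* p′))
                 refl (suc n) k x P P′ ⟩
          x * (suc n * P + k * P′)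
            ≡⟨ cong (x *_) ([n+1]Ck-rec n k) ⟩
          x * (suc n * P′)
            ≡⟨ solve 3 (λ x n p → x :* (n :* p) := n :* x :* p) refl x (suc n) P′ ⟩
          suc n * x * P′
            ≤⟨ *-monoˡ-≤ P′ deletion ⟩
          (suc n * y + k * x) * P′
            ≡⟨ solve 5 (λ n k x y p → (n :* y :+ k :* x) :* p := n :* (y :* p) :+ k :* x :* p)
                 refl (suc n) k x y P′ ⟩
          suc n * (y * P′) + k * x * P′ ∎))
    in subst₂ ℚ._≤_ t-max u-max (÷-mono-≤ x P′ y P cross)
    where
    P  = n C k
    P′ = suc n C k
    instance
      P≢0 : NonZero P
      P≢0 = nCk≢0 k≤n
      P′≢0 : NonZero P′
      P′≢0 = nCk≢0 (m≤n⇒m≤1+n k≤n)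

  maxγ-antitone-≥k : ∀ {n j} → k ≤ n → n ≤′ j → maxγ S j ℚ.≤ maxγ S n
  maxγ-antitone-≥k k≤n ≤′-refl         = ℚ.≤-refl
  maxγ-antitone-≥k k≤n (≤′-step n≤j) =
    ℚ.≤-trans (maxγ-suc (≤-trans k≤n (≤′⇒≤ n≤j))) (maxγ-antitone-≥k k≤n n≤j)

  maxγ-<k : ∀ {n} → n < k → maxγ S n ≡ 0ℚ
  -- There are no trees without leaves, so `maxγ` takes its default value 0.
  maxγ-<k {zero}  n<k = refl
  maxγ-<k {suc n} n<k =
    let t , _ , _ , eq = maximiser {suc n} (s≤s z≤n)
    in trans (sym eq) (cong (c S t ÷_) (k>n⇒nCk≡0 n<k))

  0≤maxγ : ∀ {n} → 1 ≤ n → 0ℚ ℚ.≤ maxγ S n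
  0≤maxγ {n} 1≤n =
    let t , _ , _ , eq = maximiser 1≤n
    in ℚ.≤-trans (0≤÷ (c S t) (n C k)) (ℚ.≤-reflexive eq)

  maxγ-antitone : ∀ {n j} → n ≤ j → maxγ S j ℚ.≤ maxγ S (n ⊔ k)
  maxγ-antitone {n} {j} n≤j with k ≤? j
  ... | yes k≤j = maxγ-antitone-≥k (m≤n⊔m n k) (≤⇒≤′ (⊔-lub n≤j k≤j))
  ... | no  k≰j = ℚ.≤-trans (ℚ.≤-reflexive (maxγ-<k (≰⇒> k≰j))) (0≤maxγ (1≤ (m≤n⊔m n k)))

  maxγ-rate : ∀ {n j} → k ≤ n → n ≤ j → maxγ S n ℚ.≤ maxγ S j ℚ.+ (k * (k ∸ 1)) ÷ n
  maxγ-rate {n} {j} k≤n n≤j =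
    let t , t-top , ∣t∣≡ , t-max = maximiser (1≤ k≤n)
        x = c S t
        y = c S (blowUp j t)
        x≤P : x ≤ P
        x≤P = subst (λ i → x ≤ i C k) ∣t∣≡ (c≤C S t)
        -- This is x / P ≤ y / Q + K / n, cleared of denominators; the loss (K / n) · (x / P) is at
        -- most K / n because x ≤ P.
        cross : x * (Q * n) ≤ (y * n + K * Q) * P
        cross = let open ≤-Reasoning in begin
          x * (Q * n)
            ≡⟨ cong (x *_) (*-comm Q n) ⟩
          x * (n * Q)
            ≤⟨ *-monoʳ-≤ x (nC-blowUp n m k) ⟩
          x * (K * Q + n * (m ^ k * P))
            ≡⟨ solve 6 (λ x K q n w p → x :* (K :* q :+ n :* (w :* p)) := n :* p :* (w :* x) :+ K :* q :* x)
                 refl x K Q n (m ^ k) P ⟩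
          n * P * (m ^ k * x) + K * Q * x
            ≤⟨ +-mono-≤ (*-monoʳ-≤ (n * P) (c-blowUp j S t)) (*-monoʳ-≤ (K * Q) x≤P) ⟩
          n * P * y + K * Q * P
            ≡⟨ solve 5 (λ n p y K q → n :* p :* y :+ K :* q :* p := (y :* n :+ K :* q) :* p)
                 refl n P y K Q ⟩
          (y * n + K * Q) * P ∎
        open ℚ.≤-Reasoning
    in begin
      maxγ S n                         ≡⟨ t-max ⟨
      x ÷ P                            ≤⟨ ÷-mono-≤ x P (y * n + K * Q) (Q * n) cross ⟩
      (y * n + K * Q) ÷ (Q * n)        ≡⟨ ÷-+ y Q K n ⟨
      y ÷ Q ℚ.+ K ÷ n
        ≤⟨ ℚ.+-monoˡ-≤ (K ÷ n) (ℚ.≤-trans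
             (maxγ≥ (blowUp-topological j t-top) (trans (blowUp-size j t) (cong (_* m) ∣t∣≡)))
             (maxγ-antitone-≥k (≤-trans k≤n n≤j) (≤⇒≤′ j≤nm))) ⟩
      maxγ S j ℚ.+ K ÷ n               ∎
    where
    -- Large enough that the blow-up has n m ≥ j leaves, whence monotonicity leads back down to j.
    m = 2 + j
    K = k * (k ∸ 1)
    P = n C k
    Q = (n * m) C k
    instance
      n≢0 : NonZero n
      n≢0 = >-nonZero (1≤ k≤n)
    j≤nm : j ≤ n * m
    j≤nm = ≤-trans (m≤n+m j 2) (m≤n*m m n)
    instance
      P≢0 : NonZero P
      P≢0 = nCk≢0 k≤n
      Q≢0 : NonZero Q
      Q≢0 = nCk≢0 (≤-trans k≤n (≤-trans n≤j j≤nm))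
      Qn≢0 : NonZero (Q * n)
      Qn≢0 = m*n≢0 Q n

theorem3 : ∀ S → Topological S →
    (∃ λ J → IsInducibility S J)
    × (∀ J → IsInducibility S J →
    (∀ n → ∣ S ∣ ≤ n →
    (fromℚ 0ℚ ≤ᵣ maxγᵣ S n -ᵣ J)
    × (maxγᵣ S n -ᵣ J ≤ᵣ fromℚ ((∣ S ∣ * (∣ S ∣ ∸ 1)) ÷ n)))
    × IsLimit (maxγᵣ S) J)
theorem3 S _ =
  (limit , limit-isLimsup) ,
  λ J J-limsup →
    (λ n k≤n → 0≤a-J {J} J-limsup k≤n , a-J≤e {J} J-limsup k≤n) ,
    limsup-isLimit {J} J-limsup
  where
  open MaxDensity S
  open Decreasing (maxγ S) (λ n → (∣ S ∣ * (∣ S ∣ ∸ 1)) ÷ n) ∣ S ∣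
    maxγ-antitone maxγ-rate (÷-small (∣ S ∣ * (∣ S ∣ ∸ 1)))
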